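{- Let $\sigma=\{E,C_1,C_2\}$ with $E$ binary and $C_1,C_2$ unary. There are formulas $\varphi_V(x)$ and $\varphi_E(x_1,x_2)$ of the logic $\mathcal L$ (defined in the context) over $\sigma$ and a polynomial-time algorithm that, given a graph $G$ with vertex set $V(G)=\{1,\dots,n\}$, $n\ge 1$, computes a coloured tree $T$ of height at most $2$ with $V(G)\subseteq V(T)$ such that for all $v\in V(T)$: $T\models\varphi_V[v]$ if and only if $v\in V(G)$; and for all $v_1,v_2\in V(G)$: $T\models\varphi_E[v_1,v_2]$ if and only if $\{v_1,v_2\}\in E(G)$. (The formulas $\varphi_V,\varphi_E$ do not depend on $G$ or $n$.) Consequently, the model-checking problem for $\mathcal L$ on the class of coloured trees of height at most $2$ is at least as hard as the first-order model-checking problem on the class of all graphs, and hence it is $\mathsf{AW}[*]$-hard.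
   Context: Graphs are undirected without self-loops. A coloured tree (over $\sigma$) is a $\sigma$-structure $T$ with finite non-empty universe $V(T)$ in which $E(T)$ is the (symmetric, irreflexive) edge relation of a tree and $C_1(T),C_2(T)\subseteq V(T)$ are arbitrary subsets (colours). It has height at most $2$ if it has a vertex (root) such that every vertex is at distance at most $2$ from it. The logic $\mathcal L$ over $\sigma$ consists of formulas and counting terms built by the rules: (1) $x=y$, $E(x,y)$, $C_1(x)$, $C_2(x)$ are formulas; (2) formulas are closed under $\neg,\lor$ (and hence $\land$); (3) $\exists x\,\varphi$ is a formula; (4) if $\varphi$ is a formula and $\bar x$ a tuple of pairwise distinct variables, then $\#\bar x.\varphi$ is a counting term; (5) every integer is a counting term; (6) counting terms are closed under $+$ and $\cdot$; (7) if $t_1(x)$ and $t_2(z)$ are counting terms whose only free variables are (at most) $x$ and $z$ respectively, then $E(x,y)\land E(y,z)\land\mathsf P_=(t_1(x),t_2(z))$ is a formula. Semantics: first-order constructs as usual; $\#\bar x.\varphi$ evaluates to the number of tuples of elements that, assigned to $\bar x$, satisfy $\varphi$; $\mathsf P_=(t_1,t_2)$ holds iff $t_1$ and $t_2$ evaluate to the same integer. The model-checking problem for a logic on a class of structures asks, given a sentence of the logic and a structure of the class, whether the structure satisfies the sentence; it is parameterised by the sentence. Hardness for the parameterised complexity class $\mathsf{AW}[*]$ is under fixed-parameter reductions; first-order model checking on the class of all graphs is known to be $\mathsf{AW}[*]$-hard. -}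

module Defs where

open import Data.Bool using (Bool; true; false; T; not; _∧_; _∨_; if_then_else_)
open import Data.Bool.ListAction using (any)
open import Data.Fin using (Fin; toℕ)
import Data.Fin.Properties as Fin
open import Data.Fin.Subset using (Subset; ∣_∣)
open import Data.Integer using (ℤ; +_; -[1+_])
import Data.Integer as ℤ
import Data.Integer.Properties as ℤ
open import Data.List using (List; []; _∷_; _∷ʳ_; length; filterᵇ; allFin; map; cartesianProductWith)
open import Data.List.Relation.Unary.All using (All; []; _∷_; lookupAny)
open import Data.List.Relation.Unary.Any using (Any; here; there)
open import Data.List.Relation.Unary.Linked using (Linked)
open import Data.List.Relation.Unary.Unique.Propositional using (Unique)
open import Data.Nat using (ℕ; zero; suc; _+_; _*_; _^_; _≤_; NonZero)
open import Data.Nat.ListAction using (sum)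
open import Data.Nat.Binary using (ℕᵇ; 2[1+_]; 1+[2_]; fromℕ)
import Data.Nat.Binary as ℕᵇ
open import Data.Product using (_×_; _,_; proj₁; proj₂; ∃-syntax; Σ-syntax)
open import Data.Vec using (Vec; []; _∷_; _++_; lookup)
open import Function using (_∘_)
open import Function.Bundles using (_⇔_)
open import Relation.Binary.PropositionalEquality using (_≡_)
open import Relation.Nullary using (¬_)
open import Relation.Nullary.Decidable using (⌊_⌋)

------------------------------------------------------------------------
-- A point-free version of Jones's WHILE language: every program acts on
-- one binary tree, there is general iteration, and running times are part
-- of the big-step semantics.  Building a pair is charged the size of the
-- pair built (and not one unit, as for trees with sharing), so a value
-- produced in time t from x has size at most size x + t.  Consequently
-- programs and Turing machines simulate each other with polynomial
-- overhead, for functions as well as for decision problems.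

infixr 5 _∙_
data Value : Set where
  nil : Value
  _∙_ : Value → Value → Value

size : Value → ℕ
size nil     = 1
size (x ∙ y) = suc (size x + size y)

infixr 4 _⨾_
data Program : Set where
  id′ nil′ hd tl  : Program
  _⨾_             : Program → Program → Program
  ⟨_,_⟩           : Program → Program → Program
  test_then_else_ : Program → Program → Program → Program
  while_loop_     : Program → Program → Program

hdᵛ tlᵛ : Value → Value
hdᵛ nil     = nil
hdᵛ (x ∙ y) = x
tlᵛ nil     = nil
tlᵛ (x ∙ y) = y

-- p ∶ x ⇓ y ⟨ t ⟩ : on input x, p halts with output y after time t.
-- In tests nil is false and every pair is true.
infix 3 _∶_⇓_⟨_⟩
data _∶_⇓_⟨_⟩ : Program → Value → Value → ℕ → Set where
  run-id  : ∀ {x} → id′ ∶ x ⇓ x ⟨ 1 ⟩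
  run-nil : ∀ {x} → nil′ ∶ x ⇓ nil ⟨ 1 ⟩
  run-hd  : ∀ {x} → hd ∶ x ⇓ hdᵛ x ⟨ 1 ⟩
  run-tl  : ∀ {x} → tl ∶ x ⇓ tlᵛ x ⟨ 1 ⟩
  run-⨾   : ∀ {p q x y z s t} →
            p ∶ x ⇓ y ⟨ s ⟩ → q ∶ y ⇓ z ⟨ t ⟩ →
            p ⨾ q ∶ x ⇓ z ⟨ suc (s + t) ⟩
  run-⟨,⟩ : ∀ {p q x y z s t} →
            p ∶ x ⇓ y ⟨ s ⟩ → q ∶ x ⇓ z ⟨ t ⟩ →
            ⟨ p , q ⟩ ∶ x ⇓ y ∙ z ⟨ s + t + size (y ∙ z) ⟩
  run-then : ∀ {c p q x a b y s t} →
            c ∶ x ⇓ a ∙ b ⟨ s ⟩ → p ∶ x ⇓ y ⟨ t ⟩ →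
            test c then p else q ∶ x ⇓ y ⟨ suc (s + t) ⟩
  run-else : ∀ {c p q x y s t} →
            c ∶ x ⇓ nil ⟨ s ⟩ → q ∶ x ⇓ y ⟨ t ⟩ →
            test c then p else q ∶ x ⇓ y ⟨ suc (s + t) ⟩
  run-stop : ∀ {c p x s} →
            c ∶ x ⇓ nil ⟨ s ⟩ →
            while c loop p ∶ x ⇓ x ⟨ suc s ⟩
  run-loop : ∀ {c p x a b y z s t u} →
            c ∶ x ⇓ a ∙ b ⟨ s ⟩ → p ∶ x ⇓ y ⟨ t ⟩ →
            while c loop p ∶ y ⇓ z ⟨ u ⟩ →
            while c loop p ∶ x ⇓ z ⟨ suc (s + t + u) ⟩

unary : ℕ → Value
unary zero    = nil
unary (suc n) = nil ∙ unary n

binary : ℕᵇ → Value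
binary ℕᵇ.zero  = nil
binary 2[1+ b ] = nil ∙ binary b
binary 1+[2 b ] = (nil ∙ nil) ∙ binary b

encodeBool : Bool → Value
encodeBool false = nil
encodeBool true  = nil ∙ nil

encodeFin : ∀ {n} → Fin n → Value
encodeFin i = unary (toℕ i)

encodeℤ : ℤ → Value
encodeℤ (+ n)    = nil ∙ binary (fromℕ n)
encodeℤ -[1+ n ] = (nil ∙ nil) ∙ binary (fromℕ n)

encodeList : ∀ {A : Set} → (A → Value) → List A → Value
encodeList f []       = nil
encodeList f (x ∷ xs) = f x ∙ encodeList f xs

PolynomialTime : ∀ {A B : Set} → (A → Value) → (B → Value) → (A → B) → Set
PolynomialTime encA encB f =
  Σ[ p ∈ Program ] Σ[ c ∈ ℕ ] Σ[ d ∈ ℕ ]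
    (∀ a → ∃[ t ] (p ∶ encA a ⇓ encB (f a) ⟨ t ⟩) × t ≤ c * size (encA a) ^ d)

Computable : (ℕ → ℕ) → Set
Computable f = Σ[ p ∈ Program ] (∀ n → ∃[ t ] p ∶ unary n ⇓ unary (f n) ⟨ t ⟩)

------------------------------------------------------------------------

record ParameterisedProblem : Set₁ where
  field
    Instance  : Set
    encode    : Instance → Value
    parameter : Instance → ℕ
    Yes       : Instance → Set

infix 2 _≤fpt_
record _≤fpt_ (P Q : ParameterisedProblem) : Set where
  private
    module P = ParameterisedProblem P
    module Q = ParameterisedProblem Q
  field
    reduce          : P.Instance → Q.Instance
    correct         : ∀ i → P.Yes i ⇔ Q.Yes (reduce i)
    program         : Program
    timeFactor      : ℕ → ℕ
    timeComputable  : Computable timeFactor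
    exponent        : ℕ
    computes        : ∀ i → ∃[ t ] (program ∶ P.encode i ⇓ Q.encode (reduce i) ⟨ t ⟩)
                          × t ≤ timeFactor (P.parameter i) * size (P.encode i) ^ exponent
    paramBound      : ℕ → ℕ
    paramComputable : Computable paramBound
    paramBounded    : ∀ i → Q.parameter (reduce i) ≤ paramBound (P.parameter i)

------------------------------------------------------------------------
-- The class AW[*] (Abrahamson, Downey and Fellows): the problems that are
-- fpt-reducible, for some t, to parameterised quantified satisfiability of
-- t-normalised Boolean formulas.

-- A block (m , k) is a set of m variables of which exactly k are to be set
-- to true.  The blocks of an instance are pairwise disjoint.
Block : Set
Block = ℕ × ℕ

Variable : List Block → Set
Variable = Any (Fin ∘ proj₁)

Selection : List Block → Set
Selection = All (Subset ∘ proj₁)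

valueOf : ∀ {bs} → Selection bs → Variable bs → Bool
valueOf α x = let S , i = lookupAny α x in lookup S i

data Connective : Set where
  and or : Connective

dual : Connective → Connective
dual and = or
dual or  = and

-- Normalised V and t: products of sums of products of … of literals, with
-- t alternating levels.
data Normalised (V : Set) : Connective → ℕ → Set where
  literal : ∀ {c} → Bool → V → Normalised V c zero
  join    : ∀ {c t} → List (Normalised V (dual c) t) → Normalised V c (suc t)

module _ {V : Set} (val : V → Bool) where
  mutual
    evalNormalised : ∀ {c t} → Normalised V c t → Bool
    evalNormalised (literal b x) = if b then val x else not (val x)
    evalNormalised (join {and} Fs) = evalAll Fs
    evalNormalised (join {or}  Fs) = evalAny Fs

    evalAll : ∀ {c t} → List (Normalised V c t) → Bool
    evalAll []       = true
    evalAll (F ∷ Fs) = evalNormalised F ∧ evalAll Fs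

    evalAny : ∀ {c t} → List (Normalised V c t) → Bool
    evalAny []       = false
    evalAny (F ∷ Fs) = evalNormalised F ∨ evalAny Fs

-- The quantifiers over the size-k subsets of the successive blocks
-- alternate; Exists begins with ∃ and Forall with ∀.
mutual
  Exists : (bs : List Block) → (Selection bs → Bool) → Set
  Exists []             F = T (F [])
  Exists ((m , k) ∷ bs) F =
    Σ[ S ∈ Subset m ] ∣ S ∣ ≡ k × Forall bs (λ α → F (S ∷ α))

  Forall : (bs : List Block) → (Selection bs → Bool) → Set
  Forall []             F = T (F [])
  Forall ((m , k) ∷ bs) F =
    (S : Subset m) → ∣ S ∣ ≡ k → Exists bs (λ α → F (S ∷ α))

-- A variable is encoded by the number of its block and its position there.
encodeVariable : ∀ {bs} → Variable bs → Value
encodeVariable x = unary (blockNumber x) ∙ position x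
  where
  blockNumber : ∀ {bs} → Variable bs → ℕ
  blockNumber (here _)  = 0
  blockNumber (there x) = suc (blockNumber x)

  position : ∀ {bs} → Variable bs → Value
  position (here i)  = encodeFin i
  position (there x) = position x

mutual
  encodeNormalised : ∀ {bs c t} → Normalised (Variable bs) c t → Value
  encodeNormalised (literal b x) = encodeBool b ∙ encodeVariable x
  encodeNormalised (join Fs)     = encodeNormalisedList Fs

  encodeNormalisedList : ∀ {bs c t} → List (Normalised (Variable bs) c t) → Value
  encodeNormalisedList []       = nil
  encodeNormalisedList (F ∷ Fs) = encodeNormalised F ∙ encodeNormalisedList Fs

QBFSAT : ℕ → ParameterisedProblem
QBFSAT t = record
  { Instance  = Σ[ bs ∈ List Block ] Normalised (Variable bs) and t
  ; encode    = λ (bs , F) →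
      encodeList (λ (m , k) → unary m ∙ unary k) bs ∙ encodeNormalised F
  ; parameter = λ (bs , F) → length bs + sum (map proj₂ bs)
  ; Yes       = λ (bs , F) → Exists bs (λ α → evalNormalised (valueOf α) F)
  }

_∈AW[*] : ParameterisedProblem → Set
Q ∈AW[*] = ∃[ t ] (Q ≤fpt QBFSAT t)

-- Encodings and parameters of Q are not required to be injective or
-- polynomial-time computable; as ≤fpt is transitive, that does not affect
-- which problems are hard.
AW[*]-hard : ParameterisedProblem → Set₁
AW[*]-hard P = ∀ Q → Q ∈AW[*] → Q ≤fpt P

------------------------------------------------------------------------

module _ {n : ℕ} (E : Fin n → Fin n → Bool) where

  record IsGraph : Set where
    field
      symmetric   : ∀ u v → T (E u v) → T (E v u)
      irreflexive : ∀ v → ¬ T (E v v)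

  data Walk : ℕ → Fin n → Fin n → Set where
    []  : ∀ {v} → Walk 0 v v
    _∷_ : ∀ {k u v w} → T (E u v) → Walk k v w → Walk (suc k) u w

  Connected : Set
  Connected = ∀ u v → ∃[ k ] Walk k u v

  IsCycle : Fin n → List (Fin n) → Set
  IsCycle v vs =
    Unique (v ∷ vs) × 2 ≤ length vs × Linked (λ x y → T (E x y)) (v ∷ vs ∷ʳ v)

  Acyclic : Set
  Acyclic = ∀ v vs → ¬ IsCycle v vs

  record IsTree : Set where
    field
      isGraph   : IsGraph
      connected : Connected
      acyclic   : Acyclic

  DistanceAtMost : ℕ → Fin n → Fin n → Set
  DistanceAtMost h u v = ∃[ k ] k ≤ h × Walk k u v

  HeightAtMost : ℕ → Set
  HeightAtMost h = Σ[ r ∈ Fin n ] (∀ v → DistanceAtMost h r v)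

record Graph : Set where
  field
    order        : ℕ
    {{nonEmpty}} : NonZero order
    edge         : Fin order → Fin order → Bool
    isGraph      : IsGraph edge

record Structure : Set where
  field
    order        : ℕ
    {{nonEmpty}} : NonZero order
    E            : Fin order → Fin order → Bool
    C₁ C₂        : Fin order → Bool

record ColouredTree (h : ℕ) : Set where
  field
    structure : Structure
  open Structure structure public
  field
    isTree    : IsTree E
    height    : HeightAtMost E h

encodeSet : ∀ {n} → (Fin n → Bool) → Value
encodeSet {n} C = encodeList (encodeBool ∘ C) (allFin n)

encodeMatrix : ∀ {n} → (Fin n → Fin n → Bool) → Value
encodeMatrix {n} E = encodeList (encodeSet ∘ E) (allFin n)

encodeGraph : Graph → Value
encodeGraph G = encodeMatrix (Graph.edge G)

encodeStructure : Structure → Value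
encodeStructure A = encodeMatrix E ∙ encodeSet C₁ ∙ encodeSet C₂
  where open Structure A

encodeTree : ∀ {h} → ColouredTree h → Value
encodeTree = encodeStructure ∘ ColouredTree.structure

------------------------------------------------------------------------
-- FO n consists of the formulas with free variables in Fin n; variables
-- are de Bruijn indices, 0 being the most recently bound one.

data FO (n : ℕ) : Set where
  _≐_ : Fin n → Fin n → FO n
  E   : Fin n → Fin n → FO n
  ¬′_ : FO n → FO n
  _∨′_ : FO n → FO n → FO n
  ∃′_ : FO (suc n) → FO n

encodeFO : ∀ {n} → FO n → Value
encodeFO (x ≐ y)  = unary 0 ∙ encodeFin x ∙ encodeFin y
encodeFO (E x y)  = unary 1 ∙ encodeFin x ∙ encodeFin y
encodeFO (¬′ φ)   = unary 2 ∙ encodeFO φ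
encodeFO (φ ∨′ ψ) = unary 3 ∙ encodeFO φ ∙ encodeFO ψ
encodeFO (∃′ φ)   = unary 4 ∙ encodeFO φ

module _ (G : Graph) where
  open Graph G

  evalFO : ∀ {n} → FO n → Vec (Fin order) n → Bool
  evalFO (x ≐ y)  ρ = ⌊ lookup ρ x Fin.≟ lookup ρ y ⌋
  evalFO (E x y)  ρ = edge (lookup ρ x) (lookup ρ y)
  evalFO (¬′ φ)   ρ = not (evalFO φ ρ)
  evalFO (φ ∨′ ψ) ρ = evalFO φ ρ ∨ evalFO ψ ρ
  evalFO (∃′ φ)   ρ = any (λ a → evalFO φ (a ∷ ρ)) (allFin order)

------------------------------------------------------------------------
-- Formula and Term make up the logic 𝓛, with the same convention on
-- variables; # k φ binds the k innermost variables of φ.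

mutual
  data Formula (n : ℕ) : Set where
    _≐_   : Fin n → Fin n → Formula n
    E     : Fin n → Fin n → Formula n
    C₁ C₂ : Fin n → Formula n
    ¬′_   : Formula n → Formula n
    _∨′_  : Formula n → Formula n → Formula n
    ∃′_   : Formula (suc n) → Formula n
    -- EEP₌ x y z t₁ t₂ is E(x,y) ∧ E(y,z) ∧ P₌(t₁(x),t₂(z)); the one
    -- variable of t₁ stands for x and that of t₂ for z.  x, y, z may coincide.
    EEP₌  : (x y z : Fin n) → (t₁ t₂ : Term 1) → Formula n

  data Term (n : ℕ) : Set where
    #         : (k : ℕ) → Formula (k + n) → Term n
    int       : ℤ → Term n
    _+′_ _*′_ : Term n → Term n → Term n

mutual
  encodeFormula : ∀ {n} → Formula n → Value
  encodeFormula (x ≐ y)            = unary 0 ∙ encodeFin x ∙ encodeFin y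
  encodeFormula (E x y)            = unary 1 ∙ encodeFin x ∙ encodeFin y
  encodeFormula (C₁ x)             = unary 2 ∙ encodeFin x
  encodeFormula (C₂ x)             = unary 3 ∙ encodeFin x
  encodeFormula (¬′ φ)             = unary 4 ∙ encodeFormula φ
  encodeFormula (φ ∨′ ψ)           = unary 5 ∙ encodeFormula φ ∙ encodeFormula ψ
  encodeFormula (∃′ φ)             = unary 6 ∙ encodeFormula φ
  encodeFormula (EEP₌ x y z t₁ t₂) =
    unary 7 ∙ encodeFin x ∙ encodeFin y ∙ encodeFin z ∙ encodeTerm t₁ ∙ encodeTerm t₂

  encodeTerm : ∀ {n} → Term n → Value
  encodeTerm (# k φ)  = unary 0 ∙ unary k ∙ encodeFormula φ
  encodeTerm (int i)    = unary 1 ∙ encodeℤ i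
  encodeTerm (t₁ +′ t₂) = unary 2 ∙ encodeTerm t₁ ∙ encodeTerm t₂
  encodeTerm (t₁ *′ t₂) = unary 3 ∙ encodeTerm t₁ ∙ encodeTerm t₂

tuples : (N k : ℕ) → List (Vec (Fin N) k)
tuples N zero    = [] ∷ []
tuples N (suc k) = cartesianProductWith _∷_ (allFin N) (tuples N k)

module _ (A : Structure) where
  open Structure A using (order) renaming (E to Eᴬ; C₁ to C₁ᴬ; C₂ to C₂ᴬ)

  mutual
    eval : ∀ {n} → Formula n → Vec (Fin order) n → Bool
    eval (x ≐ y)            ρ = ⌊ lookup ρ x Fin.≟ lookup ρ y ⌋
    eval (E x y)            ρ = Eᴬ (lookup ρ x) (lookup ρ y)
    eval (C₁ x)             ρ = C₁ᴬ (lookup ρ x)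
    eval (C₂ x)             ρ = C₂ᴬ (lookup ρ x)
    eval (¬′ φ)             ρ = not (eval φ ρ)
    eval (φ ∨′ ψ)           ρ = eval φ ρ ∨ eval ψ ρ
    eval (∃′ φ)             ρ = any (λ a → eval φ (a ∷ ρ)) (allFin order)
    eval (EEP₌ x y z t₁ t₂) ρ =
        Eᴬ (lookup ρ x) (lookup ρ y)
      ∧ Eᴬ (lookup ρ y) (lookup ρ z)
      ∧ ⌊ evalTerm t₁ (lookup ρ x ∷ []) ℤ.≟ evalTerm t₂ (lookup ρ z ∷ []) ⌋

    evalTerm : ∀ {n} → Term n → Vec (Fin order) n → ℤ
    evalTerm (# k φ)  ρ = + length (filterᵇ (λ as → eval φ (as ++ ρ)) (tuples order k))
    evalTerm (int i)    ρ = i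
    evalTerm (t₁ +′ t₂) ρ = evalTerm t₁ ρ ℤ.+ evalTerm t₂ ρ
    evalTerm (t₁ *′ t₂) ρ = evalTerm t₁ ρ ℤ.* evalTerm t₂ ρ

infix 4 _⊨_[_]
_⊨_[_] : ∀ {h n} (A : ColouredTree h) → Formula n → Vec (Fin (ColouredTree.order A)) n → Set
A ⊨ φ [ ρ ] = T (eval (ColouredTree.structure A) φ ρ)

------------------------------------------------------------------------

modelChecking : {Sentence Model : Set} →
                (Sentence → Value) → (Model → Value) → (Model → Sentence → Set) →
                ParameterisedProblem
modelChecking {Sentence} {Model} encS encM _⊨_ = record
  { Instance  = Sentence × Model
  ; encode    = λ (φ , A) → encS φ ∙ encM A
  ; parameter = λ (φ , A) → size (encS φ)
  ; Yes       = λ (φ , A) → A ⊨ φ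
  }

MC-FO-Graphs : ParameterisedProblem
MC-FO-Graphs = modelChecking {FO 0} {Graph} encodeFO encodeGraph (λ G φ → T (evalFO G φ []))

MC-𝓛-ColouredTrees : ℕ → ParameterisedProblem
MC-𝓛-ColouredTrees h =
  modelChecking {Formula 0} {ColouredTree h} encodeFormula encodeTree (λ A φ → A ⊨ φ [ [] ])

{-# OPTIONS --safe #-}
module Submission where

-- The root of the tree has, besides one child for every vertex, one child
-- for every pair (i , j) of adjacent vertices.  The child for vertex i has
-- i leaves of colour C₁, and the child for (i , j) has j such leaves and
-- i + 1 leaves without colour.  As any two children of the root are joined
-- by a path of length two, P₌ can compare their numbers of leaves, and so
-- recognises the two ends of an edge.
--
-- For the algorithms, polynomial-time functions on values are closed under
-- composition, pairing, case distinction and paramorphisms over binary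
-- trees whose results have polynomially bounded size; lists are right
-- spines, so this also gives maps and folds over lists.

open import Defs
open import Data.Bool using (Bool; true; false; T; not; _∧_; _∨_; if_then_else_)
open import Data.Bool.ListAction using (any)
open import Data.Bool.Properties using (T-∧)
open import Data.Empty using (⊥-elim)
open import Data.Fin using (Fin; zero; suc; toℕ; opposite; inject≤; fromℕ<)
import Data.Fin.Properties as Fin
import Data.Integer as ℤ
import Data.Integer.Properties as ℤ
open import Data.List
  using (List; []; _∷_; [_]; _∷ʳ_; _++_; map; concat; concatMap; length; tabulate; allFin; lookup;
         replicate; filterᵇ; cartesianProductWith; initLast; _∷ʳ′_)
open import Data.List.Properties
  using (map-tabulate; tabulate-lookup; tabulate-cong; map-id; length-++; length-++-≤ˡ;
         length-map; length-tabulate; ++-assoc; ++-identityʳ)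
open import Data.List.Membership.Propositional using (_∈_; find; lose)
open import Data.List.Membership.Propositional.Properties
  using (∈-++⁺ˡ; ∈-++⁺ʳ; ∈-++⁻; ∈-map⁺; ∈-map⁻; ∈-lookup; ∈-concatMap⁻; ∈-concatMap⁺; ∈-allFin)
open import Data.List.Relation.Unary.All as All using (All; []; _∷_)
import Data.List.Relation.Unary.All.Properties as All
open import Data.List.Relation.Unary.AllPairs as AllPairs using (AllPairs; []; _∷_)
import Data.List.Relation.Unary.AllPairs.Properties as AllPairs
open import Data.List.Relation.Unary.Any as Any using (here; there; index)
open import Data.List.Relation.Unary.Any.Properties using (lookup-index; any⁺; any⁻)
open import Data.List.Relation.Unary.Linked using (Linked; []; [-]; _∷_)
open import Data.List.Relation.Unary.Unique.Propositional using (Unique)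
import Data.List.Relation.Unary.Unique.Propositional.Properties as Unique
open import Data.Nat using (ℕ; zero; suc; _+_; _*_; _∸_; _^_; _≤_; _<_; _≤ᵇ_; _≡ᵇ_; z≤n; s≤s; NonZero; >-nonZero)
open import Data.Nat.Properties hiding (_≟_)
open import Data.Nat.Tactic.RingSolver using (solve-∀)
open import Data.Product using (_×_; _,_; proj₁; proj₂; Σ-syntax; ∃-syntax)
open import Data.Sum using (_⊎_; inj₁; inj₂)
open import Data.Vec as Vec using (Vec; []; _∷_)
open import Data.Vec.Properties using (lookup-map)
open import Function using (_∘_)
open import Function.Bundles using (Equivalence; _⇔_; mk⇔)
open import Function.Construct.Composition using (_⇔-∘_)
open import Relation.Nullary using (¬_)
open import Relation.Nullary.Decidable using (toWitness; fromWitness)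
open import Relation.Binary.PropositionalEquality hiding ([_])

-- Polynomial-time functions

-- The predicate P₌ relates two terms of one variable each, so no single equation can combine the
-- numbers of both ends of an edge. The pair is therefore stored at a third vertex as two separate
-- counts, and each end is compared with that vertex by an equation of its own.
--
-- The shift from i to i + 1 serves two purposes. The root must be a neighbour of every child, and
-- since it has colour `C₁`, the coloured neighbours of the child for vertex i number i + 1.
-- Moreover i + 1 is positive, while the child for a vertex has no uncoloured leaf, so the first
-- equation also keeps vertex children from posing as edges.
--
-- A path of length two that starts at a child of the root may turn around at a leaf instead of
-- passing through the root. It then ends where it began, hence still at a child, so the counts at
-- its end are those prescribed by a key.

infixl 6 _⊕_
infixl 7 _⊗_
infixl 8 _∘ₚ_

data Poly : Set where
  con     : ℕ → Poly
  var     : Poly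
  _⊕_ _⊗_ : Poly → Poly → Poly

⟦_⟧ : Poly → ℕ → ℕ
⟦ con k ⟧ n = k
⟦ var ⟧   n = n
⟦ p ⊕ q ⟧ n = ⟦ p ⟧ n + ⟦ q ⟧ n
⟦ p ⊗ q ⟧ n = ⟦ p ⟧ n * ⟦ q ⟧ n

⟦⟧-mono : ∀ p {m n} → m ≤ n → ⟦ p ⟧ m ≤ ⟦ p ⟧ n
⟦⟧-mono (con k) m≤n = ≤-refl
⟦⟧-mono var     m≤n = m≤n
⟦⟧-mono (p ⊕ q) m≤n = +-mono-≤ (⟦⟧-mono p m≤n) (⟦⟧-mono q m≤n)
⟦⟧-mono (p ⊗ q) m≤n = *-mono-≤ (⟦⟧-mono p m≤n) (⟦⟧-mono q m≤n)

_∘ₚ_ : Poly → Poly → Poly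
con k   ∘ₚ r = con k
var     ∘ₚ r = r
(p ⊕ q) ∘ₚ r = p ∘ₚ r ⊕ q ∘ₚ r
(p ⊗ q) ∘ₚ r = p ∘ₚ r ⊗ q ∘ₚ r

⟦∘⟧ : ∀ p r n → ⟦ p ∘ₚ r ⟧ n ≡ ⟦ p ⟧ (⟦ r ⟧ n)
⟦∘⟧ (con k) r n = refl
⟦∘⟧ var     r n = refl
⟦∘⟧ (p ⊕ q) r n = cong₂ _+_ (⟦∘⟧ p r n) (⟦∘⟧ q r n)
⟦∘⟧ (p ⊗ q) r n = cong₂ _*_ (⟦∘⟧ p r n) (⟦∘⟧ q r n)

⟦⟧-mono-∘ : ∀ p r {m n} → m ≤ ⟦ r ⟧ n → ⟦ p ⟧ m ≤ ⟦ p ∘ₚ r ⟧ n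
⟦⟧-mono-∘ p r {m} {n} m≤ = ≤-trans (⟦⟧-mono p m≤) (≤-reflexive (sym (⟦∘⟧ p r n)))

-- For positive n, exponents can be raised freely, so the sum of the two exponents works for sums as
-- well as for products.
monomialBound : ∀ p → Σ[ c ∈ ℕ ] Σ[ d ∈ ℕ ] (∀ n .{{_ : NonZero n}} → ⟦ p ⟧ n ≤ c * n ^ d)
monomialBound (con k) = k , 0 , λ n → ≤-reflexive (sym (*-identityʳ k))
monomialBound var     = 1 , 1 , λ n → ≤-reflexive (sym (trans (*-identityˡ (n ^ 1)) (^-identityʳ n)))
monomialBound (p ⊕ q) =
  let c , d , p≤ = monomialBound p
      c′ , d′ , q≤ = monomialBound q
  in c + c′ , d + d′ , λ n → ≤-trans
       (+-mono-≤ (≤-trans (p≤ n) (*-monoʳ-≤ c (^-monoʳ-≤ n (m≤m+n d d′))))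
                 (≤-trans (q≤ n) (*-monoʳ-≤ c′ (^-monoʳ-≤ n (m≤n+m d′ d)))))
       (≤-reflexive (sym (*-distribʳ-+ (n ^ (d + d′)) c c′)))
monomialBound (p ⊗ q) =
  let c , d , p≤ = monomialBound p
      c′ , d′ , q≤ = monomialBound q
  in c * c′ , d + d′ , λ n → ≤-trans (*-mono-≤ (p≤ n) (q≤ n)) (≤-reflexive
       (trans ([m*n]*[o*p]≡[m*o]*[n*p] c (n ^ d) c′ (n ^ d′))
              (cong (c * c′ *_) (sym (^-distribˡ-+-* n d d′)))))

-- Sizes of values, and programs that run in polynomial time.

instance
  size-nonZero : ∀ {v} → NonZero (size v)
  size-nonZero {nil}   = _
  size-nonZero {_ ∙ _} = _

1≤size : ∀ v → 1 ≤ size v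
1≤size nil     = ≤-refl
1≤size (x ∙ y) = s≤s z≤n

size-hd : ∀ x → size (hdᵛ x) ≤ size x
size-hd nil     = ≤-refl
size-hd (x ∙ y) = m≤n⇒m≤1+n (m≤m+n (size x) (size y))

size-tl : ∀ x → size (tlᵛ x) ≤ size x
size-tl nil     = ≤-refl
size-tl (x ∙ y) = m≤n⇒m≤1+n (m≤n+m (size y) (size x))

-- Only pairing can outgrow the input, and it is charged the size of its result. This is how a time
-- bound for one program bounds the input of the next.
size-output : ∀ {p x y t} → p ∶ x ⇓ y ⟨ t ⟩ → size y ≤ size x + t
size-output run-id = m≤m+n _ _
size-output run-nil = m≤n+m _ _
size-output (run-hd {x}) = m≤n⇒m≤n+o 1 (size-hd x)
size-output (run-tl {x}) = m≤n⇒m≤n+o 1 (size-tl x)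
size-output (run-⨾ {x = x} {s = s} {t = t} f g) =
  ≤-trans (size-output g) (≤-trans (+-monoˡ-≤ t (size-output f))
    (≤-trans (≤-reflexive (+-assoc (size x) s t)) (+-monoʳ-≤ (size x) (n≤1+n (s + t)))))
size-output (run-⟨,⟩ {x = x} {s = s} {t = t} f g) =
  ≤-trans (m≤n+m _ (s + t)) (m≤n+m _ (size x))
size-output (run-then {x = x} {s = s} {t = t} _ f) =
  ≤-trans (size-output f) (+-monoʳ-≤ (size x) (m≤n⇒m≤1+n (m≤n+m t s)))
size-output (run-else {x = x} {s = s} {t = t} _ f) =
  ≤-trans (size-output f) (+-monoʳ-≤ (size x) (m≤n⇒m≤1+n (m≤n+m t s)))
size-output (run-stop _) = m≤m+n _ _
size-output (run-loop {x = x} {s = s} {t = t} {u = u} _ f g) =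
  ≤-trans (size-output g) (≤-trans (+-monoˡ-≤ u (size-output f))
    (≤-trans (≤-reflexive (+-assoc (size x) t u))
      (+-monoʳ-≤ (size x) (m≤n⇒m≤1+n (+-monoˡ-≤ u (m≤n+m t s))))))

-- The function is total on values, including those that encode nothing, so the combinators compose
-- without invariants. As `fun` of a combinator computes, correctness on encodings is a separate
-- equation and often holds by `refl`.
record PolyFun : Set where
  field
    fun     : Value → Value
    program : Program
    bound   : Poly
    runs    : ∀ x → ∃[ t ] (program ∶ x ⇓ fun x ⟨ t ⟩) × t ≤ ⟦ bound ⟧ (size x)

  sizeBound : Poly
  sizeBound = var ⊕ bound

  size-fun : ∀ x → size (fun x) ≤ ⟦ sizeBound ⟧ (size x)
  size-fun x = let t , run , t≤ = runs x in
    ≤-trans (size-output run) (+-monoʳ-≤ (size x) t≤)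

open PolyFun

idᶠ nilᶠ hdᶠ tlᶠ : PolyFun
idᶠ  = record { fun = λ x → x   ; program = id′  ; bound = con 1 ; runs = λ _ → 1 , run-id  , ≤-refl }
nilᶠ = record { fun = λ _ → nil ; program = nil′ ; bound = con 1 ; runs = λ _ → 1 , run-nil , ≤-refl }
hdᶠ  = record { fun = hdᵛ       ; program = hd   ; bound = con 1 ; runs = λ _ → 1 , run-hd  , ≤-refl }
tlᶠ  = record { fun = tlᵛ       ; program = tl   ; bound = con 1 ; runs = λ _ → 1 , run-tl  , ≤-refl }

infixr 6 _⨟_
_⨟_ : PolyFun → PolyFun → PolyFun
f ⨟ g = record
  { fun     = λ x → fun g (fun f x)
  ; program = program f ⨾ program g
  ; bound   = con 1 ⊕ (bound f ⊕ bound g ∘ₚ sizeBound f)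
  ; runs    = λ x →
      let s , runᶠ , s≤ = runs f x
          t , runᵍ , t≤ = runs g (fun f x)
      in suc (s + t) , run-⨾ runᶠ runᵍ ,
         s≤s (+-mono-≤ s≤ (≤-trans t≤ (⟦⟧-mono-∘ (bound g) (sizeBound f) (size-fun f x))))
  }

infixr 5 _&_
_&_ : PolyFun → PolyFun → PolyFun
f & g = record
  { fun     = λ x → fun f x ∙ fun g x
  ; program = ⟨ program f , program g ⟩
  ; bound   = bound f ⊕ bound g ⊕ (con 1 ⊕ (sizeBound f ⊕ sizeBound g))
  ; runs    = λ x →
      let s , runᶠ , s≤ = runs f x
          t , runᵍ , t≤ = runs g x
      in s + t + size (fun f x ∙ fun g x) , run-⟨,⟩ runᶠ runᵍ ,
         +-mono-≤ (+-mono-≤ s≤ t≤) (s≤s (+-mono-≤ (size-fun f x) (size-fun g x)))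
  }

ifᵛ : Value → Value → Value → Value
ifᵛ nil     x y = y
ifᵛ (_ ∙ _) x y = x

infixr 4 if_thenᶠ_else_
if_thenᶠ_else_ : PolyFun → PolyFun → PolyFun → PolyFun
if c thenᶠ f else g = record
  { fun     = λ x → ifᵛ (fun c x) (fun f x) (fun g x)
  ; program = test program c then program f else program g
  ; bound   = con 1 ⊕ (bound c ⊕ (bound f ⊕ bound g))
  ; runs    = λ x → branch x (fun c x) (runs c x)
  }
  where
  branch : ∀ x b → ∃[ t ] (program c ∶ x ⇓ b ⟨ t ⟩) × t ≤ ⟦ bound c ⟧ (size x) →
           ∃[ t ] (test program c then program f else program g ∶ x ⇓ ifᵛ b (fun f x) (fun g x) ⟨ t ⟩)
             × t ≤ suc (⟦ bound c ⟧ (size x) + (⟦ bound f ⟧ (size x) + ⟦ bound g ⟧ (size x)))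
  branch x nil (s , runᶜ , s≤) = let t , run , t≤ = runs g x in
    _ , run-else runᶜ run , s≤s (+-mono-≤ s≤ (m≤n⇒m≤o+n (⟦ bound f ⟧ (size x)) t≤))
  branch x (_ ∙ _) (s , runᶜ , s≤) = let t , run , t≤ = runs f x in
    _ , run-then runᶜ run , s≤s (+-mono-≤ s≤ (m≤n⇒m≤n+o (⟦ bound g ⟧ (size x)) t≤))

constᶠ : Value → PolyFun
constᶠ nil     = nilᶠ
constᶠ (x ∙ y) = constᶠ x & constᶠ y

fun-constᶠ : ∀ v x → fun (constᶠ v) x ≡ v
fun-constᶠ nil     x = refl
fun-constᶠ (u ∙ v) x = cong₂ _∙_ (fun-constᶠ u x) (fun-constᶠ v x)

-- Paramorphisms over binary trees with a parameter c.  They are computed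
-- with a stack of pending tasks (nil ∙ v : evaluate v; (nil ∙ nil) ∙ v :
-- combine the results for the two halves of v) and a stack of results.

module _ (z g : Value → Value) where
  paraᵛ : Value → Value → Value
  paraᵛ c nil     = z c
  paraᵛ c (x ∙ y) = g (c ∙ x ∙ y ∙ paraᵛ c x ∙ paraᵛ c y)

-- A polynomial-time `g` alone is not enough: a step that doubles its argument would give results of
-- exponential size. With `B` given, every call of `g` has an argument of polynomial size.
module Para (z g : PolyFun) (B : Poly)
            (size-para : ∀ c v → size (paraᵛ (fun z) (fun g) c v) ≤ ⟦ B ⟧ (size c + size v)) where

  private
    para : Value → Value → Value
    para = paraᵛ (fun z) (fun g)

    tasks results item task : PolyFun
    tasks   = tlᶠ ⨟ hdᶠ
    results = tlᶠ ⨟ tlᶠ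
    item    = tasks ⨟ hdᶠ ⨟ tlᶠ
    task    = tasks ⨟ hdᶠ ⨟ hdᶠ

    step : PolyFun
    step =
      if task thenᶠ
        hdᶠ & (tasks ⨟ tlᶠ)
            -- The left half was evaluated first, so its result lies below that of the right half.
            & ((hdᶠ & (item ⨟ hdᶠ) & (item ⨟ tlᶠ) & (results ⨟ tlᶠ ⨟ hdᶠ) & (results ⨟ hdᶠ)) ⨟ g)
            & (results ⨟ tlᶠ ⨟ tlᶠ)
      else (if item thenᶠ
        hdᶠ & ((nilᶠ & (item ⨟ hdᶠ)) & (nilᶠ & (item ⨟ tlᶠ))
                 & (constᶠ (nil ∙ nil) & item) & (tasks ⨟ tlᶠ))
            & results
      else
        hdᶠ & (tasks ⨟ tlᶠ) & (hdᶠ ⨟ z) & results)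

    loop : Program
    loop = while (tl ⨾ hd) loop program step

    -- R bounds the results, M what a node contributes to the two stacks, Q
    -- the stacks, S the whole state, and τ the time of one iteration.
    module Loop (n : ℕ) (c : Value) (c≤n : size c ≤ n) where

      R M Q S τ : ℕ
      R = ⟦ B ⟧ (n + n)
      M = 8 + (n + n) + R
      Q = 2 + n * M
      S = 20 + (n + n) + (R + R) + Q
      τ = 4 + ⟦ bound step ⟧ S

      size-para≤ : ∀ v → size v ≤ n → size (para c v) ≤ R
      size-para≤ v v≤n = ≤-trans (size-para c v) (⟦⟧-mono B (+-mono-≤ c≤n v≤n))

      iterate : ∀ {i todo res x u} → size (c ∙ (i ∙ todo) ∙ res) ≤ S →
                loop ∶ fun step (c ∙ (i ∙ todo) ∙ res) ⇓ x ⟨ u ⟩ →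
                ∃[ t ] (loop ∶ c ∙ (i ∙ todo) ∙ res ⇓ x ⟨ t ⟩) × t ≤ τ + u
      iterate {i} {todo} {res} {u = u} ≤S run = let t , run₁ , t≤ = runs step (c ∙ (i ∙ todo) ∙ res) in
        _ , run-loop (run-⨾ run-tl run-hd) run₁ run ,
        -- The test `tl ⨾ hd` takes time 3, and the iteration itself is charged 1.
        +-monoˡ-≤ u (+-monoʳ-≤ 4 (≤-trans t≤ (⟦⟧-mono (bound step) ≤S)))

      -- Stated in continuation style: a run from the state after the evaluation of `v` is extended
      -- backwards, so runs of the loop never have to be concatenated. The summand `size v * M` is a
      -- credit, from which each pair draws `M` to pay for what it puts on the stacks. A pair takes
      -- two iterations and `nil` one, whence at most twice the size.
      evaluate : ∀ v todo res {x u} → size v ≤ n →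
                 size todo + size res + size v * M ≤ Q →
                 loop ∶ c ∙ todo ∙ (para c v ∙ res) ⇓ x ⟨ u ⟩ →
                 ∃[ t ] (loop ∶ c ∙ ((nil ∙ v) ∙ todo) ∙ res ⇓ x ⟨ t ⟩) × t ≤ (size v + size v) * τ + u
      evaluate nil todo res {u = u} v≤n ≤Q run =
        let t , run′ , t≤ = iterate {i = nil ∙ nil} size≤ run
        in t , run′ , ≤-trans t≤ (+-monoˡ-≤ u (m≤m+n τ (τ + 0)))
        where
        size≤ : size (c ∙ ((nil ∙ nil) ∙ todo) ∙ res) ≤ S
        size≤ = begin
          size (c ∙ ((nil ∙ nil) ∙ todo) ∙ res) ≡⟨ eq (size c) (size todo) (size res) ⟩
          6 + (size c + 0) + 0 + (size todo + size res + 0)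
            ≤⟨ +-mono-≤ (+-mono-≤ (+-mono-≤ (m≤m+n 6 14) (+-mono-≤ c≤n z≤n)) z≤n)
                 (≤-trans (+-monoʳ-≤ (size todo + size res) z≤n) ≤Q) ⟩
          S ∎
          where
          open ≤-Reasoning
          eq : ∀ c t r → suc (c + suc (suc (3 + t) + r)) ≡ 6 + (c + 0) + 0 + (t + r + 0)
          eq = solve-∀
      evaluate v@(x ∙ y) todo res {u = u} v≤n ≤Q run =
        let t₃ , run₃ , t₃≤ = iterate {i = (nil ∙ nil) ∙ v} size₃ run
            t₂ , run₂ , t₂≤ = evaluate y (((nil ∙ nil) ∙ v) ∙ todo) (para c x ∙ res) y≤n y≤Q run₃
            t₁ , run₁ , t₁≤ = evaluate x ((nil ∙ y) ∙ ((nil ∙ nil) ∙ v) ∙ todo) res x≤n x≤Q run₂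
            t₀ , run₀ , t₀≤ = iterate {i = nil ∙ v} size₀ run₁
        in t₀ , run₀ , (begin
             t₀ ≤⟨ t₀≤ ⟩
             τ + t₁ ≤⟨ +-monoʳ-≤ τ t₁≤ ⟩
             τ + ((size x + size x) * τ + t₂) ≤⟨ +-monoʳ-≤ τ (+-monoʳ-≤ ((size x + size x) * τ) t₂≤) ⟩
             τ + ((size x + size x) * τ + ((size y + size y) * τ + t₃))
               ≤⟨ +-monoʳ-≤ τ (+-monoʳ-≤ ((size x + size x) * τ) (+-monoʳ-≤ ((size y + size y) * τ) t₃≤)) ⟩
             τ + ((size x + size x) * τ + ((size y + size y) * τ + (τ + u))) ≡⟨ cost (size x) (size y) τ u ⟩
             (size v + size v) * τ + u ∎)
        where
        open ≤-Reasoning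
        x≤n : size x ≤ n
        x≤n = ≤-trans (size-hd v) v≤n
        y≤n : size y ≤ n
        y≤n = ≤-trans (size-tl v) v≤n
        cost : ∀ x y τ u → τ + ((x + x) * τ + ((y + y) * τ + (τ + u))) ≡ (suc (x + y) + suc (x + y)) * τ + u
        cost = solve-∀
        split : ∀ t r x y M → t + r + suc (x + y) * M ≡ M + (t + r + (x + y) * M)
        split = solve-∀
        todo+res≤Q : size todo + size res ≤ Q
        todo+res≤Q = ≤-trans (m≤m+n _ _) ≤Q
        x≤Q : size ((nil ∙ y) ∙ ((nil ∙ nil) ∙ v) ∙ todo) + size res + size x * M ≤ Q
        x≤Q = begin
          size ((nil ∙ y) ∙ ((nil ∙ nil) ∙ v) ∙ todo) + size res + size x * M
            ≡⟨ eq (size v) (size y) (size todo) (size res) (size x * M) ⟩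
          (8 + (size y + size v) + 0) + (size todo + size res + size x * M)
            ≤⟨ +-mono-≤ (+-mono-≤ (+-monoʳ-≤ 8 (+-mono-≤ y≤n v≤n)) z≤n)
                 (+-monoʳ-≤ (size todo + size res) (*-monoˡ-≤ M (m≤m+n (size x) (size y)))) ⟩
          M + (size todo + size res + (size x + size y) * M)
            ≡⟨ split (size todo) (size res) (size x) (size y) M ⟨
          size todo + size res + size v * M ≤⟨ ≤Q ⟩
          Q ∎
          where
          eq : ∀ v y t r m → suc (suc (suc y) + suc (suc (3 + v) + t)) + r + m ≡ (8 + (y + v) + 0) + (t + r + m)
          eq = solve-∀
        y≤Q : size (((nil ∙ nil) ∙ v) ∙ todo) + size (para c x ∙ res) + size y * M ≤ Q
        y≤Q = begin
          size (((nil ∙ nil) ∙ v) ∙ todo) + size (para c x ∙ res) + size y * M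
            ≡⟨ eq (size v) (size (para c x)) (size todo) (size res) (size y * M) ⟩
          (6 + (size v + 0) + size (para c x)) + (size todo + size res + size y * M)
            ≤⟨ +-mono-≤ (+-mono-≤ (+-mono-≤ (m≤m+n 6 2) (+-mono-≤ v≤n z≤n)) (size-para≤ x x≤n))
                 (+-monoʳ-≤ (size todo + size res) (*-monoˡ-≤ M (m≤n+m (size y) (size x)))) ⟩
          M + (size todo + size res + (size x + size y) * M)
            ≡⟨ split (size todo) (size res) (size x) (size y) M ⟨
          size todo + size res + size v * M ≤⟨ ≤Q ⟩
          Q ∎
          where
          eq : ∀ v p t r m → suc (suc (3 + v) + t) + suc (p + r) + m ≡ (6 + (v + 0) + p) + (t + r + m)
          eq = solve-∀
        size₀ : size (c ∙ ((nil ∙ v) ∙ todo) ∙ res) ≤ S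
        size₀ = begin
          size (c ∙ ((nil ∙ v) ∙ todo) ∙ res) ≡⟨ eq (size c) (size v) (size todo) (size res) ⟩
          5 + (size c + size v) + 0 + (size todo + size res)
            ≤⟨ +-mono-≤ (+-mono-≤ (+-mono-≤ (m≤m+n 5 15) (+-mono-≤ c≤n v≤n)) z≤n) todo+res≤Q ⟩
          S ∎
          where
          eq : ∀ c v t r → suc (c + suc (suc (suc (suc v) + t) + r)) ≡ 5 + (c + v) + 0 + (t + r)
          eq = solve-∀
        size₃ : size (c ∙ (((nil ∙ nil) ∙ v) ∙ todo) ∙ (para c y ∙ para c x ∙ res)) ≤ S
        size₃ = begin
          size (c ∙ (((nil ∙ nil) ∙ v) ∙ todo) ∙ (para c y ∙ para c x ∙ res))
            ≡⟨ eq (size c) (size v) (size (para c x)) (size (para c y)) (size todo) (size res) ⟩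
          9 + (size c + size v) + (size (para c x) + size (para c y)) + (size todo + size res)
            ≤⟨ +-mono-≤ (+-mono-≤ (+-mono-≤ (m≤m+n 9 11) (+-mono-≤ c≤n v≤n))
                 (+-mono-≤ (size-para≤ x x≤n) (size-para≤ y y≤n))) todo+res≤Q ⟩
          S ∎
          where
          eq : ∀ c v p q t r → suc (c + suc (suc (suc (3 + v) + t) + suc (q + suc (p + r)))) ≡ 9 + (c + v) + (p + q) + (t + r)
          eq = solve-∀

    Mᴾ Rᴾ Sᴾ loopBound : Poly
    Rᴾ = B ∘ₚ (var ⊕ var)
    Mᴾ = con 8 ⊕ (var ⊕ var) ⊕ Rᴾ
    Sᴾ = con 20 ⊕ (var ⊕ var) ⊕ (Rᴾ ⊕ Rᴾ) ⊕ (con 2 ⊕ var ⊗ Mᴾ)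
    loopBound = (var ⊕ var) ⊗ (con 4 ⊕ bound step ∘ₚ Sᴾ) ⊕ con 4

    start finish : PolyFun
    start  = hdᶠ & ((nilᶠ & tlᶠ) & nilᶠ) & nilᶠ
    finish = tlᶠ ⨟ tlᶠ ⨟ hdᶠ

    -- The value of `τ` is the same for all parameters, so `nil` can stand for any of them.
    bounds-agree : ∀ n → let open Loop n nil in
      (c≤n : 1 ≤ n) → (n + n) * τ c≤n + 4 ≡ ⟦ loopBound ⟧ n
    bounds-agree n c≤n rewrite ⟦∘⟧ (bound step) Sᴾ n | ⟦∘⟧ B (var ⊕ var) n = refl

    loop-runs : ∀ x → ∃[ t ] (loop ∶ fun start x ⇓ hdᵛ x ∙ nil ∙ (para (hdᵛ x) (tlᵛ x) ∙ nil) ⟨ t ⟩)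
                        × t ≤ ⟦ loopBound ⟧ (size x)
    loop-runs x = let t , run , t≤ = evaluate (tlᵛ x) nil nil (size-tl x) start≤ (run-stop (run-⨾ run-tl run-hd)) in
      t , run , (begin
        t                                    ≤⟨ t≤ ⟩
        (size (tlᵛ x) + size (tlᵛ x)) * τ + 4 ≤⟨ +-monoˡ-≤ 4 (*-monoˡ-≤ τ (+-mono-≤ (size-tl x) (size-tl x))) ⟩
        (size x + size x) * τ + 4            ≡⟨ bounds-agree (size x) (1≤size x) ⟩
        ⟦ loopBound ⟧ (size x)               ∎)
      where
      open Loop (size x) (hdᵛ x) (size-hd x)
      open ≤-Reasoning
      -- The 2 is the size of two empty stacks.
      start≤ : 2 + size (tlᵛ x) * M ≤ Q
      start≤ = +-monoʳ-≤ 2 (*-monoˡ-≤ M (size-tl x))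

    loopᶠ : PolyFun
    loopᶠ = record
      { fun     = λ x → hdᵛ x ∙ nil ∙ (para (hdᵛ x) (tlᵛ x) ∙ nil)
      ; program = program start ⨾ loop
      ; bound   = con 1 ⊕ (bound start ⊕ loopBound)
      ; runs    = λ x →
          let s , runˢ , s≤ = runs start x
              t , runˡ , t≤ = loop-runs x
          in suc (s + t) , run-⨾ runˢ runˡ , s≤s (+-mono-≤ s≤ t≤)
      }

  paraᶠ : PolyFun
  paraᶠ = loopᶠ ⨟ finish

open Para using (paraᶠ)

-- Maps, folds and unary arithmetic on encoded lists.

trueᶠ : PolyFun
trueᶠ = constᶠ (nil ∙ nil)

-- The components of the argument c ∙ x ∙ y ∙ u ∙ w that paraᵛ passes to
-- its step function.
parameterᶠ leftᶠ rightᶠ leftResultᶠ rightResultᶠ : PolyFun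
parameterᶠ   = hdᶠ
leftᶠ        = tlᶠ ⨟ hdᶠ
rightᶠ       = tlᶠ ⨟ tlᶠ ⨟ hdᶠ
leftResultᶠ  = tlᶠ ⨟ tlᶠ ⨟ tlᶠ ⨟ hdᶠ
rightResultᶠ = tlᶠ ⨟ tlᶠ ⨟ tlᶠ ⨟ tlᶠ

module MapTails (h : PolyFun) where

  private
    entry : PolyFun
    entry = (parameterᶠ & leftᶠ & rightᶠ) ⨟ h

    -- The bound n stays fixed while `v` shrinks, so that all entries share one size bound.
    size-entries : ∀ c v {n} → size v ≤ n →
      size (paraᵛ (fun nilᶠ) (fun (entry & rightResultᶠ)) c v)
        ≤ size v * (1 + ⟦ sizeBound h ⟧ (1 + (size c + n)))
    size-entries c nil     v≤n = s≤s z≤n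
    size-entries c (x ∙ y) {n} v≤n = s≤s (+-mono-≤
      (≤-trans (size-fun h (c ∙ x ∙ y)) (⟦⟧-mono (sizeBound h) (s≤s (+-monoʳ-≤ (size c) v≤n))))
      (≤-trans (size-entries c y (≤-trans (size-tl (x ∙ y)) v≤n))
               (*-monoˡ-≤ (1 + ⟦ sizeBound h ⟧ (1 + (size c + n))) (m≤n+m (size y) (size x)))))

  mapTailsᶠ : PolyFun
  mapTailsᶠ = paraᶠ nilᶠ (entry & rightResultᶠ)
    (var ⊗ (con 1 ⊕ sizeBound h ∘ₚ (con 1 ⊕ var)))
    (λ c v → ≤-trans (size-entries c v ≤-refl)
      (*-mono-≤ (m≤n+m (size v) (size c))
        (s≤s (⟦⟧-mono-∘ (sizeBound h) (con 1 ⊕ var) {n = size c + size v} ≤-refl))))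

open MapTails using (mapTailsᶠ)

mapTails : ∀ {A B : Set} → (A → ℕ → B) → List A → List B
mapTails k []       = []
mapTails k (x ∷ xs) = k x (length xs) ∷ mapTails k xs

fun-mapTailsᶠ : ∀ {A B : Set} {f : A → Value} {g : B → Value} {k : A → ℕ → B} h c →
  (∀ x xs → fun h (c ∙ f x ∙ encodeList f xs) ≡ g (k x (length xs))) →
  ∀ xs → fun (mapTailsᶠ h) (c ∙ encodeList f xs) ≡ encodeList g (mapTails k xs)
fun-mapTailsᶠ h c eq []       = refl
fun-mapTailsᶠ h c eq (x ∷ xs) = cong₂ _∙_ (eq x xs) (fun-mapTailsᶠ h c eq xs)

mapTails-tabulate : ∀ {A B : Set} (k : A → ℕ → B) {n} (h : Fin n → A) →
  mapTails k (tabulate h) ≡ tabulate (λ i → k (h i) (toℕ (opposite i)))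
mapTails-tabulate k {zero}  h = refl
mapTails-tabulate k {suc n} h = cong₂ _∷_
  (cong (k (h zero)) (trans (length-tabulate (h ∘ suc)) (sym (Fin.toℕ-fromℕ n))))
  (trans (mapTails-tabulate k (h ∘ suc))
         (tabulate-cong (λ i → cong (k (h (suc i))) (sym (Fin.toℕ-inject₁ (opposite i))))))

mapTails-allFin : ∀ {B : Set} n (k : Fin n → ℕ → B) →
  mapTails k (allFin n) ≡ map (λ i → k i (toℕ (opposite i))) (allFin n)
mapTails-allFin n k = trans (mapTails-tabulate k (λ i → i)) (sym (map-tabulate (λ i → i) _))

mapᶠ : PolyFun → PolyFun
mapᶠ h = mapTailsᶠ ((hdᶠ & tlᶠ ⨟ hdᶠ) ⨟ h)

fun-mapᶠ : ∀ {A B : Set} {f : A → Value} {g : B → Value} {k : A → B} h c →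
  (∀ x → fun h (c ∙ f x) ≡ g (k x)) →
  ∀ xs → fun (mapᶠ h) (c ∙ encodeList f xs) ≡ encodeList g (map k xs)
fun-mapᶠ h c eq []       = refl
fun-mapᶠ h c eq (x ∷ xs) = cong₂ _∙_ (eq x) (fun-mapᶠ h c eq xs)

private
  size-append : ∀ c v → size (paraᵛ (fun idᶠ) (fun (leftᶠ & rightResultᶠ)) c v) ≤ size c + size v
  size-append c nil     = m≤m+n (size c) 1
  size-append c (x ∙ y) = begin
    suc (size x + _)                 ≤⟨ s≤s (+-monoʳ-≤ (size x) (size-append c y)) ⟩
    suc (size x + (size c + size y)) ≡⟨ eq (size x) (size c) (size y) ⟩
    size c + size (x ∙ y)            ∎
    where
    open ≤-Reasoning
    eq : ∀ x c y → suc (x + (c + y)) ≡ c + suc (x + y)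
    eq = solve-∀

-- The second list is the parameter, because it replaces the final `nil` of the first.
appendᶠ : PolyFun
appendᶠ = paraᶠ idᶠ (leftᶠ & rightResultᶠ) var size-append

fun-appendᶠ : ∀ {A : Set} (f : A → Value) xs ys →
  fun appendᶠ (encodeList f ys ∙ encodeList f xs) ≡ encodeList f (xs ++ ys)
fun-appendᶠ f []       ys = refl
fun-appendᶠ f (x ∷ xs) ys = cong (f x ∙_) (fun-appendᶠ f xs ys)

private
  size-concat : ∀ c v →
    size (paraᵛ (fun nilᶠ) (fun ((rightResultᶠ & leftᶠ) ⨟ appendᶠ)) c v) ≤ size v
  size-concat c nil     = ≤-refl
  size-concat c (x ∙ y) = ≤-trans (size-append _ x) (≤-trans (+-monoˡ-≤ (size x) (size-concat c y))
    (≤-trans (≤-reflexive (+-comm (size y) (size x))) (n≤1+n _)))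

concatᶠ : PolyFun
concatᶠ = (nilᶠ & idᶠ) ⨟ paraᶠ nilᶠ ((rightResultᶠ & leftᶠ) ⨟ appendᶠ) var
  (λ c v → ≤-trans (size-concat c v) (m≤n+m (size v) (size c)))

fun-concatᶠ : ∀ {A : Set} (f : A → Value) xss →
  fun concatᶠ (encodeList (encodeList f) xss) ≡ encodeList f (concat xss)
fun-concatᶠ f []         = refl
fun-concatᶠ f (xs ∷ xss) =
  trans (cong (λ v → fun appendᶠ (v ∙ encodeList f xs)) (fun-concatᶠ f xss)) (fun-appendᶠ f xs (concat xss))

-- A unary numeral is a list of copies of `nil`, so a list is counted by replacing each entry by
-- `nil`.
lengthᶠ : PolyFun
lengthᶠ = (nilᶠ & idᶠ) ⨟ mapᶠ nilᶠ

fun-lengthᶠ : ∀ {A : Set} (f : A → Value) xs → fun lengthᶠ (encodeList f xs) ≡ unary (length xs)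
fun-lengthᶠ f []       = refl
fun-lengthᶠ f (x ∷ xs) = cong (nil ∙_) (fun-lengthᶠ f xs)

private
  size-monus : ∀ c v → size (paraᵛ (fun idᶠ) (fun (rightResultᶠ ⨟ tlᶠ)) c v) ≤ size c
  size-monus c nil     = ≤-refl
  size-monus c (x ∙ y) = ≤-trans (size-tl (paraᵛ _ _ c y)) (size-monus c y)

monusᶠ : PolyFun
monusᶠ = paraᶠ idᶠ (rightResultᶠ ⨟ tlᶠ) var
  (λ c v → ≤-trans (size-monus c v) (m≤m+n (size c) (size v)))

fun-monusᶠ : ∀ a b → fun monusᶠ (unary a ∙ unary b) ≡ unary (a ∸ b)
fun-monusᶠ a zero    = refl
fun-monusᶠ a (suc b) =
  trans (cong tlᵛ (fun-monusᶠ a b)) (trans (tl-unary (a ∸ b)) (cong unary (pred[m∸n]≡m∸[1+n] a b)))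
  where
  tl-unary : ∀ m → tlᵛ (unary m) ≡ unary (m ∸ 1)
  tl-unary zero    = refl
  tl-unary (suc m) = refl

notᶠ : PolyFun
notᶠ = if idᶠ thenᶠ nilᶠ else trueᶠ

-- Numbers are equal when both truncated differences vanish.
eqUnaryᶠ : PolyFun
eqUnaryᶠ = if monusᶠ thenᶠ nilᶠ else (tlᶠ & hdᶠ) ⨟ monusᶠ ⨟ notᶠ

fun-eqUnaryᶠ : ∀ a b → fun eqUnaryᶠ (unary a ∙ unary b) ≡ encodeBool (a ≡ᵇ b)
fun-eqUnaryᶠ a b rewrite fun-monusᶠ a b | fun-monusᶠ b a = both-zero a b
  where
  both-zero : ∀ a b → ifᵛ (unary (a ∸ b)) nil (fun notᶠ (unary (b ∸ a))) ≡ encodeBool (a ≡ᵇ b)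
  both-zero zero    zero    = refl
  both-zero zero    (suc b) = refl
  both-zero (suc a) zero    = refl
  both-zero (suc a) (suc b) = both-zero a b

private
  size-times : ∀ c v →
    size (paraᵛ (fun nilᶠ) (fun ((parameterᶠ & rightResultᶠ) ⨟ appendᶠ)) c v) ≤ size c * size v
  size-times c nil     = ≤-trans (1≤size c) (≤-reflexive (sym (*-identityʳ (size c))))
  size-times c (x ∙ y) = begin
    _                             ≤⟨ size-append c (paraᵛ (fun nilᶠ) (fun ((parameterᶠ & rightResultᶠ) ⨟ appendᶠ)) c y) ⟩
    size c + _                    ≤⟨ +-monoʳ-≤ (size c) (size-times c y) ⟩
    size c + size c * size y      ≡⟨ *-suc (size c) (size y) ⟨
    size c * suc (size y)         ≤⟨ *-monoʳ-≤ (size c) (s≤s (m≤n+m (size y) (size x))) ⟩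
    size c * size (x ∙ y)         ∎
    where open ≤-Reasoning

-- Products and powers are needed to compute the time factor and the parameter bound of a composed
-- reduction.
timesᶠ : PolyFun
timesᶠ = paraᶠ nilᶠ ((parameterᶠ & rightResultᶠ) ⨟ appendᶠ) (var ⊗ var)
  (λ c v → ≤-trans (size-times c v) (*-mono-≤ (m≤m+n (size c) (size v)) (m≤n+m (size v) (size c))))

append-unary : ∀ a b → fun appendᶠ (unary b ∙ unary a) ≡ unary (a + b)
append-unary zero    b = refl
append-unary (suc a) b = cong (nil ∙_) (append-unary a b)

fun-timesᶠ : ∀ a b → fun timesᶠ (unary a ∙ unary b) ≡ unary (a * b)
fun-timesᶠ a zero    = cong unary (sym (*-zeroʳ a))
fun-timesᶠ a (suc b) = begin
  fun appendᶠ (unary a ∙ fun timesᶠ (unary a ∙ unary b)) ≡⟨ cong (λ v → fun appendᶠ (unary a ∙ v)) (fun-timesᶠ a b) ⟩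
  fun appendᶠ (unary a ∙ unary (a * b))                  ≡⟨ append-unary (a * b) a ⟩
  unary (a * b + a)                                      ≡⟨ cong unary (+-comm (a * b) a) ⟩
  unary (a + a * b)                                      ≡⟨ cong unary (*-suc a b) ⟨
  unary (a * suc b)                                      ∎
  where open ≡-Reasoning

powerᶠ : ℕ → PolyFun
powerᶠ zero    = constᶠ (unary 1)
powerᶠ (suc d) = (idᶠ & powerᶠ d) ⨟ timesᶠ

fun-powerᶠ : ∀ d a → fun (powerᶠ d) (unary a) ≡ unary (a ^ d)
fun-powerᶠ zero    a = refl
fun-powerᶠ (suc d) a = trans (cong (λ v → fun timesᶠ (unary a ∙ v)) (fun-powerᶠ d a)) (fun-timesᶠ a (a ^ d))

-- The tree of a graph

Key : Set
Key = ℕ × ℕ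

-- The vertices of the tree: the child with key (a , b) of the root has b
-- leaves of colour C₁ and a leaves without colour.
data Node : Set where
  root  : Node
  child : Key → Node
  leaf  : Bool → Key → Node

_==_ : Key → Key → Bool
(a , b) == (a′ , b′) = (a ≡ᵇ a′) ∧ (b ≡ᵇ b′)

adjacent : Node → Node → Bool
adjacent root       (child _)   = true
adjacent (child _)  root        = true
adjacent (child k)  (leaf _ k′) = k == k′
adjacent (leaf _ k) (child k′)  = k == k′
adjacent _          _           = false

-- The colour of the root adds one to the count of coloured neighbours at each child. The second
-- colour marks the children without plain leaves, which are the vertices of the graph.
colour₁ colour₂ : Node → Bool
colour₁ root       = true
colour₁ (child _)  = false
colour₁ (leaf c _) = c
colour₂ (child (zero , _)) = true
colour₂ _                  = false

leaves : Key → List Node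
leaves k@(a , b) = replicate b (leaf true k) ++ replicate a (leaf false k)

-- Vertex children come first, so every vertex of the graph keeps its number in the tree.
nodes : List Key → List Key → List Node
nodes vs es = map child vs ++ root ∷ map child es ++ concatMap leaves (vs ++ es)

-- Numbering from the end makes the number of a row (or entry) the length
-- of the list of the rows (entries) after it.
countdown : ∀ {n} → Fin n → ℕ
countdown i = toℕ (opposite i)

vertexKeys : ∀ n → List Key
vertexKeys n = map (λ i → 0 , countdown i) (allFin n)

edgeKeysAt : ∀ {n} → (Fin n → Bool) → ℕ → List Key
edgeKeysAt {n} row a = concatMap (λ j → if row j then [ suc a , countdown j ] else []) (allFin n)

edgeKeys : ∀ {n} → (Fin n → Fin n → Bool) → List Key
edgeKeys {n} edge = concatMap (λ i → edgeKeysAt (edge i) (countdown i)) (allFin n)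

graphNodes : ∀ {n} → (Fin n → Fin n → Bool) → List Node
graphNodes {n} edge = nodes (vertexKeys n) (edgeKeys edge)

-- Programs that compute the tree.

encodeKey : Key → Value
encodeKey (a , b) = unary a ∙ unary b

-- Whether the code is `nil`, and whether its head is, tells the three kinds of node apart.
encodeNode : Node → Value
encodeNode root       = nil
encodeNode (child k)  = nil ∙ encodeKey k
encodeNode (leaf c k) = (nil ∙ encodeBool c) ∙ encodeKey k

encodeNodes : List Node → Value
encodeNodes us =
    encodeList (λ u → encodeList (encodeBool ∘ adjacent u) us) us
  ∙ encodeList (encodeBool ∘ colour₁) us ∙ encodeList (encodeBool ∘ colour₂) us

andᶠ : PolyFun → PolyFun → PolyFun
andᶠ f g = if f thenᶠ g else nilᶠ

fun-andᶠ : ∀ f g {x b c} → fun f x ≡ encodeBool b → fun g x ≡ encodeBool c →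
           fun (andᶠ f g) x ≡ encodeBool (b ∧ c)
fun-andᶠ f g {b = true}  eq eq′ rewrite eq = eq′
fun-andᶠ f g {b = false} eq eq′ rewrite eq = refl

eqKeyᶠ : PolyFun
eqKeyᶠ = andᶠ ((hdᶠ ⨟ hdᶠ & tlᶠ ⨟ hdᶠ) ⨟ eqUnaryᶠ) ((hdᶠ ⨟ tlᶠ & tlᶠ ⨟ tlᶠ) ⨟ eqUnaryᶠ)

fun-eqKeyᶠ : ∀ k k′ → fun eqKeyᶠ (encodeKey k ∙ encodeKey k′) ≡ encodeBool (k == k′)
fun-eqKeyᶠ (a , b) (a′ , b′) =
  fun-andᶠ ((hdᶠ ⨟ hdᶠ & tlᶠ ⨟ hdᶠ) ⨟ eqUnaryᶠ) ((hdᶠ ⨟ tlᶠ & tlᶠ ⨟ tlᶠ) ⨟ eqUnaryᶠ)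
    {x = encodeKey (a , b) ∙ encodeKey (a′ , b′)} (fun-eqUnaryᶠ a a′) (fun-eqUnaryᶠ b b′)

adjacentᶠ : PolyFun
adjacentᶠ =
  if hdᶠ thenᶠ
    if hdᶠ ⨟ hdᶠ thenᶠ
      if tlᶠ thenᶠ if tlᶠ ⨟ hdᶠ thenᶠ nilᶠ else sameKey else nilᶠ
    else
      if tlᶠ thenᶠ if tlᶠ ⨟ hdᶠ thenᶠ sameKey else nilᶠ else trueᶠ
  else
    if tlᶠ thenᶠ tlᶠ ⨟ hdᶠ ⨟ notᶠ else nilᶠ
  where
  sameKey : PolyFun
  sameKey = (hdᶠ ⨟ tlᶠ & tlᶠ ⨟ tlᶠ) ⨟ eqKeyᶠ

fun-adjacentᶠ : ∀ u v → fun adjacentᶠ (encodeNode u ∙ encodeNode v) ≡ encodeBool (adjacent u v)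
fun-adjacentᶠ root       root        = refl
fun-adjacentᶠ root       (child _)   = refl
fun-adjacentᶠ root       (leaf _ _)  = refl
fun-adjacentᶠ (child _)  root        = refl
fun-adjacentᶠ (child _)  (child _)   = refl
fun-adjacentᶠ (child k)  (leaf _ k′) = fun-eqKeyᶠ k k′
fun-adjacentᶠ (leaf _ _) root        = refl
fun-adjacentᶠ (leaf _ k) (child k′)  = fun-eqKeyᶠ k k′
fun-adjacentᶠ (leaf _ _) (leaf _ _)  = refl

colour₁ᶠ colour₂ᶠ : PolyFun
colour₁ᶠ = if idᶠ thenᶠ hdᶠ ⨟ tlᶠ else trueᶠ
colour₂ᶠ = if idᶠ thenᶠ if hdᶠ thenᶠ nilᶠ else tlᶠ ⨟ hdᶠ ⨟ notᶠ else nilᶠ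

fun-colour₁ᶠ : ∀ u → fun colour₁ᶠ (encodeNode u) ≡ encodeBool (colour₁ u)
fun-colour₁ᶠ root       = refl
fun-colour₁ᶠ (child _)  = refl
fun-colour₁ᶠ (leaf _ _) = refl

fun-colour₂ᶠ : ∀ u → fun colour₂ᶠ (encodeNode u) ≡ encodeBool (colour₂ u)
fun-colour₂ᶠ root                = refl
fun-colour₂ᶠ (child (zero , _))  = refl
fun-colour₂ᶠ (child (suc _ , _)) = refl
fun-colour₂ᶠ (leaf _ _)          = refl

encodeList-map : ∀ {A B : Set} (g : B → Value) (k : A → B) xs →
                 encodeList g (map k xs) ≡ encodeList (g ∘ k) xs
encodeList-map g k []       = refl
encodeList-map g k (x ∷ xs) = cong (g (k x) ∙_) (encodeList-map g k xs)

-- For the matrix, the outer map carries the whole list as its parameter. The swap then turns the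
-- current node into the parameter of an inner map over that list.
nodesToStructureᶠ : PolyFun
nodesToStructureᶠ =
    (idᶠ & idᶠ) ⨟ mapᶠ ((tlᶠ & hdᶠ) ⨟ mapᶠ adjacentᶠ)
  & (nilᶠ & idᶠ) ⨟ mapᶠ (tlᶠ ⨟ colour₁ᶠ)
  & (nilᶠ & idᶠ) ⨟ mapᶠ (tlᶠ ⨟ colour₂ᶠ)

fun-nodesToStructureᶠ : ∀ us → fun nodesToStructureᶠ (encodeList encodeNode us) ≡ encodeNodes us
fun-nodesToStructureᶠ us = cong₂ _∙_
  (trans (fun-mapᶠ {g = row} {k = λ u → u} ((tlᶠ & hdᶠ) ⨟ mapᶠ adjacentᶠ) (encodeList encodeNode us)
           (λ u → trans (fun-mapᶠ {g = encodeBool} adjacentᶠ (encodeNode u) (fun-adjacentᶠ u) us)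
                        (encodeList-map encodeBool (adjacent u) us)) us)
         (cong (encodeList row) (map-id us)))
  (cong₂ _∙_ (unaryMap colour₁ᶠ colour₁ fun-colour₁ᶠ) (unaryMap colour₂ᶠ colour₂ fun-colour₂ᶠ))
  where
  row : Node → Value
  row u = encodeList (encodeBool ∘ adjacent u) us
  unaryMap : ∀ (h : PolyFun) (k : Node → Bool) → (∀ u → fun h (encodeNode u) ≡ encodeBool (k u)) →
             fun (mapᶠ (tlᶠ ⨟ h)) (nil ∙ encodeList encodeNode us) ≡ encodeList (encodeBool ∘ k) us
  unaryMap h k eq = trans (fun-mapᶠ {g = encodeBool} (tlᶠ ⨟ h) nil eq us) (encodeList-map encodeBool k us)

leavesᶠ : PolyFun
leavesᶠ = ( (idᶠ & hdᶠ) ⨟ mapᶠ ((nilᶠ & nilᶠ) & hdᶠ)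
          & (idᶠ & tlᶠ) ⨟ mapᶠ ((nilᶠ & trueᶠ) & hdᶠ) ) ⨟ appendᶠ

fun-leavesᶠ : ∀ k → fun leavesᶠ (encodeKey k) ≡ encodeList encodeNode (leaves k)
fun-leavesᶠ k@(a , b) = trans
  (cong₂ (λ u v → fun appendᶠ (u ∙ v)) (copies ((nilᶠ & nilᶠ) & hdᶠ) false (λ _ → refl) a)
                                       (copies ((nilᶠ & trueᶠ) & hdᶠ) true (λ _ → refl) b))
  (fun-appendᶠ encodeNode (replicate b (leaf true k)) (replicate a (leaf false k)))
  where
  copies : ∀ h c → (∀ v → fun h (encodeKey k ∙ v) ≡ encodeNode (leaf c k)) →
    ∀ m → fun (mapᶠ h) (encodeKey k ∙ unary m) ≡ encodeList encodeNode (replicate m (leaf c k))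
  copies h c eq zero    = refl
  copies h c eq (suc m) = cong₂ _∙_ (eq nil) (copies h c eq m)

nodesᶠ : PolyFun
nodesᶠ =
  ( ( (nilᶠ & appendᶠ) ⨟ mapᶠ (tlᶠ ⨟ leavesᶠ) ⨟ concatᶠ
    & (nilᶠ & hdᶠ) ⨟ childrenᶠ ) ⨟ consRootAppendᶠ
  & (nilᶠ & tlᶠ) ⨟ childrenᶠ ) ⨟ appendᶠ
  where
  childrenᶠ consRootAppendᶠ : PolyFun
  childrenᶠ       = mapᶠ (nilᶠ & tlᶠ)
  consRootAppendᶠ = nilᶠ & appendᶠ

fun-nodesᶠ : ∀ vs es → fun nodesᶠ (encodeList encodeKey es ∙ encodeList encodeKey vs)
                       ≡ encodeList encodeNode (nodes vs es)
fun-nodesᶠ vs es = trans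
  (cong₂ (λ u v → fun appendᶠ (u ∙ v))
    (cong (nil ∙_) (trans (cong₂ (λ u v → fun appendᶠ (u ∙ v)) leaves≡ (children≡ es))
                          (fun-appendᶠ encodeNode (map child es) (concatMap leaves (vs ++ es)))))
    (children≡ vs))
  (fun-appendᶠ encodeNode (map child vs) _)
  where
  children≡ : ∀ ks → fun (mapᶠ (nilᶠ & tlᶠ)) (nil ∙ encodeList encodeKey ks) ≡ encodeList encodeNode (map child ks)
  children≡ ks = fun-mapᶠ (nilᶠ & tlᶠ) nil (λ _ → refl) ks
  leaves≡ : fun ((nilᶠ & appendᶠ) ⨟ mapᶠ (tlᶠ ⨟ leavesᶠ) ⨟ concatᶠ) (encodeList encodeKey es ∙ encodeList encodeKey vs)
            ≡ encodeList encodeNode (concatMap leaves (vs ++ es))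
  leaves≡ = trans
    (cong (fun concatᶠ) (trans
      (cong (λ v → fun (mapᶠ (tlᶠ ⨟ leavesᶠ)) (nil ∙ v)) (fun-appendᶠ encodeKey vs es))
      (fun-mapᶠ (tlᶠ ⨟ leavesᶠ) nil fun-leavesᶠ (vs ++ es))))
    (fun-concatᶠ encodeNode (map leaves (vs ++ es)))

vertexKeysᶠ : PolyFun
vertexKeysᶠ = (nilᶠ & idᶠ) ⨟ mapTailsᶠ (nilᶠ & tlᶠ ⨟ tlᶠ ⨟ lengthᶠ)

fun-vertexKeysᶠ : ∀ {n} (f : Fin n → Value) →
  fun vertexKeysᶠ (encodeList f (allFin n)) ≡ encodeList encodeKey (vertexKeys n)
fun-vertexKeysᶠ {n} f = trans
  (fun-mapTailsᶠ {k = λ _ l → 0 , l} (nilᶠ & tlᶠ ⨟ tlᶠ ⨟ lengthᶠ) nil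
    (λ _ js → cong (nil ∙_) (fun-lengthᶠ f js)) (allFin n))
  (cong (encodeList encodeKey) (mapTails-allFin n (λ _ l → 0 , l)))

edgeKeysAtᶠ : PolyFun
edgeKeysAtᶠ = mapTailsᶠ (if tlᶠ ⨟ hdᶠ thenᶠ ((nilᶠ & hdᶠ) & tlᶠ ⨟ tlᶠ ⨟ lengthᶠ) & nilᶠ else nilᶠ) ⨟ concatᶠ

fun-edgeKeysAtᶠ : ∀ {n} (row : Fin n → Bool) a →
  fun edgeKeysAtᶠ (unary a ∙ encodeSet row) ≡ encodeList encodeKey (edgeKeysAt row a)
fun-edgeKeysAtᶠ {n} row a = trans
  (cong (fun concatᶠ) (trans
    (fun-mapTailsᶠ {k = k} (if tlᶠ ⨟ hdᶠ thenᶠ ((nilᶠ & hdᶠ) & tlᶠ ⨟ tlᶠ ⨟ lengthᶠ) & nilᶠ else nilᶠ) (unary a)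
      entry (allFin n))
    (cong (encodeList (encodeList encodeKey)) (mapTails-allFin n k))))
  (fun-concatᶠ encodeKey (map (λ j → k j (countdown j)) (allFin n)))
  where
  k : Fin n → ℕ → List Key
  k j l = if row j then [ suc a , l ] else []
  entry : ∀ j js → ifᵛ (encodeBool (row j)) (((nil ∙ unary a) ∙ fun lengthᶠ (encodeList (encodeBool ∘ row) js)) ∙ nil) nil
                   ≡ encodeList encodeKey (k j (length js))
  entry j js with row j
  ... | true  = cong (λ v → ((nil ∙ unary a) ∙ v) ∙ nil) (fun-lengthᶠ (encodeBool ∘ row) js)
  ... | false = refl

edgeKeysᶠ : PolyFun
edgeKeysᶠ = (nilᶠ & idᶠ) ⨟ mapTailsᶠ ((tlᶠ ⨟ tlᶠ ⨟ lengthᶠ & tlᶠ ⨟ hdᶠ) ⨟ edgeKeysAtᶠ) ⨟ concatᶠ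

fun-edgeKeysᶠ : ∀ {n} (edge : Fin n → Fin n → Bool) →
  fun edgeKeysᶠ (encodeMatrix edge) ≡ encodeList encodeKey (edgeKeys edge)
fun-edgeKeysᶠ {n} edge = trans
  (cong (fun concatᶠ) (trans
    (fun-mapTailsᶠ {k = edgeKeysAt ∘ edge} ((tlᶠ ⨟ tlᶠ ⨟ lengthᶠ & tlᶠ ⨟ hdᶠ) ⨟ edgeKeysAtᶠ) nil
      (λ i is → trans (cong (λ v → fun edgeKeysAtᶠ (v ∙ encodeSet (edge i))) (fun-lengthᶠ (encodeSet ∘ edge) is))
                      (fun-edgeKeysAtᶠ (edge i) (length is))) (allFin n))
    (cong (encodeList (encodeList encodeKey)) (mapTails-allFin n (edgeKeysAt ∘ edge)))))
  (fun-concatᶠ encodeKey (map (λ i → edgeKeysAt (edge i) (countdown i)) (allFin n)))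

graphToStructureᶠ : PolyFun
graphToStructureᶠ = (edgeKeysᶠ & vertexKeysᶠ) ⨟ nodesᶠ ⨟ nodesToStructureᶠ

fun-graphToStructureᶠ : ∀ {n} (edge : Fin n → Fin n → Bool) →
  fun graphToStructureᶠ (encodeMatrix edge) ≡ encodeNodes (graphNodes edge)
fun-graphToStructureᶠ {n} edge = trans
  (cong (fun nodesToStructureᶠ) (trans
    (cong₂ (λ u v → fun nodesᶠ (u ∙ v)) (fun-edgeKeysᶠ edge) (fun-vertexKeysᶠ (encodeSet ∘ edge)))
    (fun-nodesᶠ (vertexKeys n) (edgeKeys edge))))
  (fun-nodesToStructureᶠ (graphNodes edge))

-- Tree properties

==⇒≡ : ∀ k k′ → T (k == k′) → k ≡ k′
==⇒≡ (a , b) (a′ , b′) eq =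
  let eq₁ , eq₂ = Equivalence.to T-∧ eq in cong₂ _,_ (≡ᵇ⇒≡ a a′ eq₁) (≡ᵇ⇒≡ b b′ eq₂)

==-refl : ∀ k → T (k == k)
==-refl (a , b) = Equivalence.from T-∧ (≡⇒≡ᵇ a a refl , ≡⇒≡ᵇ b b refl)

root-adjacent⁻ : ∀ v → T (adjacent root v) → ∃[ k ] v ≡ child k
root-adjacent⁻ (child k) _ = k , refl

child-adjacent⁻ : ∀ {k} v → T (adjacent (child k) v) → v ≡ root ⊎ (∃[ c ] v ≡ leaf c k)
child-adjacent⁻     root        _   = inj₁ refl
child-adjacent⁻ {k} (leaf c k′) adj = inj₂ (c , cong (leaf c) (sym (==⇒≡ k k′ adj)))

leaf-adjacent⁻ : ∀ {c k} v → T (adjacent (leaf c k) v) → v ≡ child k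
leaf-adjacent⁻ {k = k} (child k′) adj = cong child (sym (==⇒≡ k k′ adj))

adjacent-sym : ∀ u v → T (adjacent u v) → T (adjacent v u)
adjacent-sym root       v adj with root-adjacent⁻ v adj
... | _ , refl = _
adjacent-sym (child k)  v adj with child-adjacent⁻ v adj
... | inj₁ refl       = _
... | inj₂ (_ , refl) = ==-refl k
adjacent-sym (leaf _ k) v adj with leaf-adjacent⁻ v adj
... | refl = ==-refl k

adjacent-irrefl : ∀ u → ¬ T (adjacent u u)
adjacent-irrefl root       ()
adjacent-irrefl (child _)  ()
adjacent-irrefl (leaf _ _) ()

-- Walks and cycles in arbitrary graphs.

module _ {n} {E : Fin n → Fin n → Bool} where

  infixr 5 _++ʷ_
  _++ʷ_ : ∀ {k l u v w} → Walk E k u v → Walk E l v w → Walk E (k + l) u w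
  []       ++ʷ w′ = w′
  (e ∷ w) ++ʷ w′ = e ∷ (w ++ʷ w′)

  reverseWalk : (∀ u v → T (E u v) → T (E v u)) → ∀ {k u v} → Walk E k u v → ∃[ l ] Walk E l v u
  reverseWalk E-sym []      = 0 , []
  reverseWalk E-sym (e ∷ w) = _ , proj₂ (reverseWalk E-sym w) ++ʷ (E-sym _ _ e ∷ [])

  HeightAtMost⇒Connected : (∀ u v → T (E u v) → T (E v u)) → ∀ {h} → HeightAtMost E h → Connected E
  HeightAtMost⇒Connected E-sym (r , walks) u v =
    let _ , _ , r⇝u = walks u
        _ , _ , r⇝v = walks v
    in _ , proj₂ (reverseWalk E-sym r⇝u) ++ʷ r⇝v

  module _ {R : Fin n → Fin n → Set} where

    Linked-∷ʳ : ∀ xs {v w} → Linked R (xs ∷ʳ v) → R v w → Linked R ((xs ∷ʳ v) ∷ʳ w)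
    Linked-∷ʳ []           _        r = r ∷ [-]
    Linked-∷ʳ (x ∷ [])     (r′ ∷ _) r = r′ ∷ r ∷ [-]
    Linked-∷ʳ (x ∷ y ∷ xs) (r′ ∷ l) r = r′ ∷ Linked-∷ʳ (y ∷ xs) l r

    Linked-last : ∀ xs {v w} → Linked R ((xs ∷ʳ v) ∷ʳ w) → R v w
    Linked-last []           (r ∷ _) = r
    Linked-last (x ∷ [])     (_ ∷ l) = Linked-last [] l
    Linked-last (x ∷ y ∷ xs) (_ ∷ l) = Linked-last (y ∷ xs) l

  rotate : ∀ {v x xs} → IsCycle E v (x ∷ xs) → IsCycle E x (xs ∷ʳ v)
  rotate {v} {x} {xs} (v∉ ∷ unique , 2≤ , e ∷ linked) =
      AllPairs.++⁺ unique ([] ∷ []) (All.map (λ v≢ → (v≢ ∘ sym) ∷ []) v∉)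
    , ≤-trans 2≤ (≤-reflexive (trans (+-comm 1 (length xs)) (sym (length-++ xs))))
    , Linked-∷ʳ (x ∷ xs) linked e

  OnCycle : Fin n → Set
  OnCycle v = ∃[ vs ] IsCycle E v vs

  -- The list `ys` collects the vertices that have been rotated to the end.
  OnCycle-rotations : ∀ xs {v ys} → IsCycle E v (xs ++ ys) → All OnCycle xs
  OnCycle-rotations []       cycle = []
  OnCycle-rotations (x ∷ xs) {v} {ys} cycle =
    (_ , cycle′) ∷ OnCycle-rotations xs (subst (IsCycle E x) (++-assoc xs ys [ v ]) cycle′)
    where
    cycle′ : IsCycle E x ((xs ++ ys) ∷ʳ v)
    cycle′ = rotate cycle

  -- The two neighbours are the second and the last vertex of the cycle, which differ because a
  -- cycle has at least three vertices. This makes acyclicity a local matter: a vertex with at most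
  -- one neighbour on cycles lies on none.
  OnCycle-neighbours : ∀ {v} → OnCycle v →
    ∃[ x ] ∃[ y ] x ≢ y × (T (E v x) × OnCycle x) × (T (E y v) × OnCycle y)
  OnCycle-neighbours (x ∷ ys , cycle@(_ ∷ (x∉ ∷ _) , _ , e ∷ linked)) with initLast ys | cycle
  ... | []       | (_ , s≤s () , _)
  ... | zs ∷ʳ′ y | _ =
    x , y , All.lookup x∉ (∈-++⁺ʳ zs (here refl))
      , (e , All.head onCycle)
      , (Linked-last (x ∷ zs) linked , All.lookup onCycle (there (∈-++⁺ʳ zs (here refl))))
    where
    onCycle : All OnCycle (x ∷ zs ∷ʳ y)
    onCycle = OnCycle-rotations (x ∷ zs ∷ʳ y) {ys = []}
      (subst (IsCycle E _) (sym (++-identityʳ (x ∷ zs ∷ʳ y))) cycle)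

-- Lists of nodes as coloured trees of height two.

nodeStructure : ∀ us → root ∈ us → Structure
nodeStructure us root∈ = record
  { order    = length us
  ; nonEmpty = Fin.nonZeroIndex (index root∈)
  ; E        = λ i j → adjacent (lookup us i) (lookup us j)
  ; C₁       = colour₁ ∘ lookup us
  ; C₂       = colour₂ ∘ lookup us
  }

encodeList-cong : ∀ {A : Set} {f g : A → Value} → (∀ x → f x ≡ g x) → ∀ xs → encodeList f xs ≡ encodeList g xs
encodeList-cong f≗g []       = refl
encodeList-cong f≗g (x ∷ xs) = cong₂ _∙_ (f≗g x) (encodeList-cong f≗g xs)

encodeList-allFin : ∀ {A : Set} (f : A → Value) (xs : List A) →
                    encodeList (f ∘ lookup xs) (allFin (length xs)) ≡ encodeList f xs
encodeList-allFin f xs = trans (sym (encodeList-map f (lookup xs) (allFin (length xs))))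
  (cong (encodeList f) (trans (map-tabulate (λ i → i) (lookup xs)) (tabulate-lookup xs)))

encode-nodeStructure : ∀ us root∈ → encodeStructure (nodeStructure us root∈) ≡ encodeNodes us
encode-nodeStructure us root∈ = cong₂ _∙_
  (trans (encodeList-cong (λ i → encodeList-allFin (encodeBool ∘ adjacent (lookup us i)) us) (allFin (length us)))
         (encodeList-allFin (λ u → encodeList (encodeBool ∘ adjacent u) us) us))
  (cong₂ _∙_ (encodeList-allFin (encodeBool ∘ colour₁) us) (encodeList-allFin (encodeBool ∘ colour₂) us))

IsLeaf : Node → Set
IsLeaf v = ∃[ c ] ∃[ k ] v ≡ leaf c k

leaves-of : ∀ k → All (λ v → ∃[ c ] v ≡ leaf c k) (leaves k)
leaves-of k@(a , b) = All.++⁺ (All.replicate⁺ b (true , refl)) (All.replicate⁺ a (false , refl))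

∈-leaves⁻ : ∀ {c k} k′ → leaf c k ∈ leaves k′ → k ≡ k′
∈-leaves⁻ k′ ∈leaves with All.lookup (leaves-of k′) ∈leaves
... | _ , refl = refl

module NodeTree (vs es : List Key) (unique-vs : Unique vs) (unique-es : Unique es)
                (disjoint : All (λ k → All (k ≢_) es) vs) where

  us : List Node
  us = nodes vs es

  root∈us : root ∈ us
  root∈us = ∈-++⁺ʳ (map child vs) (here refl)

  child∈us : ∀ {k} → k ∈ vs ++ es → child k ∈ us
  child∈us k∈ with ∈-++⁻ vs k∈
  ... | inj₁ k∈vs = ∈-++⁺ˡ (∈-map⁺ child k∈vs)
  ... | inj₂ k∈es = ∈-++⁺ʳ (map child vs) (there (∈-++⁺ˡ (∈-map⁺ child k∈es)))

  allLeaves : All IsLeaf (concatMap leaves (vs ++ es))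
  allLeaves = All.concat⁺ (All.map⁺ (All.universal (λ k → All.map (λ (c , eq) → c , k , eq) (leaves-of k)) (vs ++ es)))

  leaf∈us⁻ : ∀ {c k} → leaf c k ∈ us → k ∈ vs ++ es
  leaf∈us⁻ leaf∈ with ∈-++⁻ (map child vs) leaf∈
  ... | inj₁ ∈vs with ∈-map⁻ child ∈vs
  ...   | _ , _ , ()
  leaf∈us⁻ leaf∈ | inj₂ (there ∈rest) with ∈-++⁻ (map child es) ∈rest
  ...   | inj₁ ∈es with ∈-map⁻ child ∈es
  ...     | _ , _ , ()
  leaf∈us⁻ leaf∈ | inj₂ (there ∈rest) | inj₂ ∈leaves =
    Any.map (λ {k′} → ∈-leaves⁻ k′) (∈-concatMap⁻ leaves ∈leaves)

  private
    -- The elements of the structure are positions in the list, since the leaves of one child with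
    -- the same colour are equal as nodes. Every parent is the root or a child, so it suffices that
    -- the positions of these are determined by their nodes.
    OnlyLeavesRepeat : Node → Node → Set
    OnlyLeavesRepeat u v = u ≡ v → IsLeaf u

    only-leaves-repeat : AllPairs OnlyLeavesRepeat us
    only-leaves-repeat = AllPairs.++⁺ (children unique-vs)
      (All.++⁺ (All.map⁺ (All.universal (λ _ ()) es)) (All.map (λ { (_ , _ , refl) () }) allLeaves)
        ∷ AllPairs.++⁺ (children unique-es) (leaves-repeat allLeaves) (All.map⁺ (All.universal notLeaf es)))
      (All.map⁺ (All.map (λ v∉es → (λ ()) ∷ All.++⁺ (All.map⁺ (All.map differ v∉es)) (notLeaf _)) disjoint))
      where
      differ : ∀ {k k′} → k ≢ k′ → OnlyLeavesRepeat (child k) (child k′)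
      differ k≢ refl = ⊥-elim (k≢ refl)
      children : ∀ {ks} → Unique ks → AllPairs OnlyLeavesRepeat (map child ks)
      children = AllPairs.map⁺ ∘ AllPairs.map differ
      notLeaf : ∀ k → All (OnlyLeavesRepeat (child k)) (concatMap leaves (vs ++ es))
      notLeaf k = All.map (λ { (_ , _ , refl) () }) allLeaves
      leaves-repeat : ∀ {ls} → All IsLeaf ls → AllPairs OnlyLeavesRepeat ls
      leaves-repeat []               = []
      leaves-repeat (isLeaf ∷ areLeaves) = All.universal (λ _ _ → isLeaf) _ ∷ leaves-repeat areLeaves

  lookup-injective : ∀ {i j} → ¬ IsLeaf (lookup us i) → lookup us i ≡ lookup us j → i ≡ j
  lookup-injective = go only-leaves-repeat
    where
    go : ∀ {ws} → AllPairs OnlyLeavesRepeat ws → ∀ {i j} →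
         ¬ IsLeaf (lookup ws i) → lookup ws i ≡ lookup ws j → i ≡ j
    go (_ ∷ _)  {zero}  {zero}  _       _  = refl
    go (r ∷ _)  {zero}  {suc j} ¬isLeaf eq = ⊥-elim (¬isLeaf (All.lookup r (∈-lookup j) eq))
    go (r ∷ _)  {suc i} {zero}  ¬isLeaf eq =
      ⊥-elim (¬isLeaf (subst IsLeaf (sym eq) (All.lookup r (∈-lookup i) (sym eq))))
    go (_ ∷ rs) {suc i} {suc j} ¬isLeaf eq = cong suc (go rs ¬isLeaf eq)

  structure : Structure
  structure = nodeStructure us root∈us

  open Structure structure using () renaming (E to edge)

  edge-sym : ∀ i j → T (edge i j) → T (edge j i)
  edge-sym i j = adjacent-sym (lookup us i) (lookup us j)

  edge-to : ∀ {i v} (v∈ : v ∈ us) → T (adjacent (lookup us i) v) → T (edge i (index v∈))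
  edge-to {i} v∈ = subst (T ∘ adjacent (lookup us i)) (lookup-index v∈)

  height : HeightAtMost edge 2
  height = index root∈us , λ i → walk i (lookup us i) refl
    where
    from-root : ∀ {j v} → lookup us j ≡ v → T (adjacent root v) → T (edge (index root∈us) j)
    from-root {j} refl = subst (λ u → T (adjacent u (lookup us j))) (lookup-index root∈us)
    walk : ∀ i v → lookup us i ≡ v → DistanceAtMost edge 2 (index root∈us) i
    walk i root eq = 0 , z≤n , subst (Walk edge 0 (index root∈us))
      (lookup-injective (λ isLeaf → root-¬leaf (subst IsLeaf (sym (lookup-index root∈us)) isLeaf))
        (trans (sym (lookup-index root∈us)) (sym eq))) []
      where
      root-¬leaf : ¬ IsLeaf root
      root-¬leaf (_ , _ , ())
    walk i (child k) eq = 1 , s≤s z≤n , from-root eq _ ∷ []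
    walk i (leaf c k) eq = 2 , s≤s (s≤s z≤n) ,
      from-root (sym (lookup-index child∈)) _
        ∷ edge-sym i (index child∈) (edge-to {i} child∈ (subst (λ v → T (adjacent v (child k))) (sym eq) (==-refl k))) ∷ []
      where
      child∈ : child k ∈ us
      child∈ = child∈us (leaf∈us⁻ (subst (_∈ us) eq (∈-lookup i)))

  private
    repeated : ∀ {i j v} → ¬ IsLeaf v → lookup us i ≡ v → lookup us j ≡ v → i ≡ j
    repeated ¬isLeaf refl eq = lookup-injective ¬isLeaf (sym eq)

    leaf-∉cycle : ∀ {i c k} → lookup us i ≡ leaf c k → ¬ OnCycle {E = edge} i
    leaf-∉cycle {i} {c} {k} eq onCycle with OnCycle-neighbours onCycle
    ... | x , y , x≢y , (ix , _) , (yi , _) = x≢y (repeated (λ { (_ , _ , ()) }) (parent ix) (parent (edge-sym y i yi)))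
      where
      parent : ∀ {j} → T (edge i j) → lookup us j ≡ child k
      parent {j} ij = leaf-adjacent⁻ (lookup us j) (subst (λ u → T (adjacent u (lookup us j))) eq ij)

    -- With the leaves excluded from cycles, the root is the only neighbour left, and it occupies a
    -- single position.
    child-∉cycle : ∀ {i k} → lookup us i ≡ child k → ¬ OnCycle {E = edge} i
    child-∉cycle {i} {k} eq onCycle with OnCycle-neighbours onCycle
    ... | x , y , x≢y , (ix , x∈) , (yi , y∈) = x≢y (repeated (λ { (_ , _ , ()) }) (parent ix x∈) (parent (edge-sym y i yi) y∈))
      where
      parent : ∀ {j} → T (edge i j) → OnCycle {E = edge} j → lookup us j ≡ root
      parent {j} ij j∈ with child-adjacent⁻ (lookup us j) (subst (λ u → T (adjacent u (lookup us j))) eq ij)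
      ... | inj₁ eq′       = eq′
      ... | inj₂ (_ , eq′) = ⊥-elim (leaf-∉cycle eq′ j∈)

    root-∉cycle : ∀ {i} → lookup us i ≡ root → ¬ OnCycle {E = edge} i
    root-∉cycle {i} eq onCycle with OnCycle-neighbours onCycle
    ... | x , _ , _ , (ix , x∈) , _ =
      child-∉cycle (proj₂ (root-adjacent⁻ (lookup us x) (subst (λ u → T (adjacent u (lookup us x))) eq ix))) x∈

    ∉cycle : ∀ {i} v → lookup us i ≡ v → ¬ OnCycle {E = edge} i
    ∉cycle root       = root-∉cycle
    ∉cycle (child _)  = child-∉cycle
    ∉cycle (leaf _ _) = leaf-∉cycle

  tree : ColouredTree 2
  tree = record
    { structure = structure
    ; isTree    = record
      { isGraph   = record { symmetric = edge-sym ; irreflexive = adjacent-irrefl ∘ lookup us }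
      ; connected = HeightAtMost⇒Connected edge-sym height
      ; acyclic   = λ v vs cycle → ∉cycle {v} (lookup us v) refl (vs , cycle)
      }
    ; height    = height
    }

-- The formulas

infixr 6 _∧′_
_∧′_ : ∀ {n} → Formula n → Formula n → Formula n
φ ∧′ ψ = ¬′ ((¬′ φ) ∨′ (¬′ ψ))

-- In the trees below, child (a , b) has value suc b under the first term
-- (the root has colour C₁) and value a under the second.
colouredNeighbours plainNeighbours : Term 1
colouredNeighbours = # 1 (E (suc zero) zero ∧′ C₁ zero)
plainNeighbours    = # 1 (E (suc zero) zero ∧′ (¬′ C₁ zero))

-- Index 1 is the child that stores the edge, and index 0 is the common middle of both paths. With
-- keys (0 , i), (0 , j) and (a , b) for x, y and that child, the equations say i + 1 = a and j + 1
-- = b + 1.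
edgeFormula : ∀ {n} → Fin n → Fin n → Formula n
edgeFormula x y = ∃′ (∃′
  (    EEP₌ (suc (suc x)) zero (suc zero) colouredNeighbours plainNeighbours
   ∧′ EEP₌ (suc (suc y)) zero (suc zero) colouredNeighbours colouredNeighbours))

translate : ∀ {n} → FO n → Formula n
translate (x ≐ y)  = x ≐ y
translate (E x y)  = edgeFormula x y
translate (¬′ φ)   = ¬′ translate φ
translate (φ ∨′ ψ) = translate φ ∨′ translate ψ
translate (∃′ φ)   = ∃′ (C₂ zero ∧′ translate φ)

deMorgan : ∀ a b → not (not a ∨ not b) ≡ a ∧ b
deMorgan false b     = refl
deMorgan true  false = refl
deMorgan true  true  = refl

T-any-allFin : ∀ {n} {p : Fin n → Bool} → T (any p (allFin n)) ⇔ (∃[ i ] T (p i))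
T-any-allFin {n} {p} = mk⇔ (λ t → let i , _ , pi = find (any⁻ p (allFin n) t) in i , pi)
                           (λ (i , pi) → any⁺ p (lose (∈-allFin i) pi))

T-ext : ∀ {a b} → (T a → T b) → (T b → T a) → a ≡ b
T-ext {true}  {true}  f g = refl
T-ext {true}  {false} f g = ⊥-elim (f _)
T-ext {false} {true}  f g = ⊥-elim (g _)
T-ext {false} {false} f g = refl

module _ (A : Structure) {n} (ρ : Vec (Fin (Structure.order A)) n) where
  open Structure A using () renaming (E to edge)

  eval-∧′ : ∀ φ ψ → eval A (φ ∧′ ψ) ρ ≡ eval A φ ρ ∧ eval A ψ ρ
  eval-∧′ φ ψ = deMorgan (eval A φ ρ) (eval A ψ ρ)

  ⊨-∧′ : ∀ φ ψ → T (eval A (φ ∧′ ψ) ρ) ⇔ (T (eval A φ ρ) × T (eval A ψ ρ))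
  ⊨-∧′ φ ψ = subst (λ b → T b ⇔ (T (eval A φ ρ) × T (eval A ψ ρ))) (sym (eval-∧′ φ ψ)) T-∧

  ⊨-∃′ : ∀ φ → T (eval A (∃′ φ) ρ) ⇔ (∃[ i ] T (eval A φ (i ∷ ρ)))
  ⊨-∃′ φ = T-any-allFin {p = λ i → eval A φ (i ∷ ρ)}

  ⊨-EEP₌ : ∀ x y z t₁ t₂ → let ρx = Vec.lookup ρ x ; ρy = Vec.lookup ρ y ; ρz = Vec.lookup ρ z in
    T (eval A (EEP₌ x y z t₁ t₂) ρ) ⇔
      (T (edge ρx ρy) × T (edge ρy ρz) × evalTerm A t₁ (ρx ∷ []) ≡ evalTerm A t₂ (ρz ∷ []))
  ⊨-EEP₌ x y z t₁ t₂ = mk⇔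
    (λ t → let xy , t′ = Equivalence.to (T-∧ {x = xyᵇ}) t
               yz , eq = Equivalence.to (T-∧ {x = yzᵇ}) t′
           in xy , yz , toWitness eq)
    (λ (xy , yz , eq) → Equivalence.from (T-∧ {x = xyᵇ}) (xy , Equivalence.from (T-∧ {x = yzᵇ}) (yz , fromWitness eq)))
    where
    xyᵇ yzᵇ : Bool
    xyᵇ = edge (Vec.lookup ρ x) (Vec.lookup ρ y)
    yzᵇ = edge (Vec.lookup ρ y) (Vec.lookup ρ z)

-- Counting the neighbours of a child.

count : ∀ {A : Set} → (A → Bool) → List A → ℕ
count p xs = length (filterᵇ p xs)

count-∷ : ∀ {A : Set} (p : A → Bool) x xs → count p (x ∷ xs) ≡ (if p x then 1 else 0) + count p xs
count-∷ p x xs with p x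
... | true  = refl
... | false = refl

count-++ : ∀ {A : Set} (p : A → Bool) xs ys → count p (xs ++ ys) ≡ count p xs + count p ys
count-++ p []       ys = refl
count-++ p (x ∷ xs) ys with p x
... | true  = cong suc (count-++ p xs ys)
... | false = count-++ p xs ys

count-map : ∀ {A B : Set} {p : A → Bool} {q : B → Bool} {f : A → B} →
            (∀ x → p x ≡ q (f x)) → ∀ xs → count p xs ≡ count q (map f xs)
count-map p≗q []       = refl
count-map {p = p} {q} {f} p≗q (x ∷ xs) =
  trans (count-∷ p x xs) (trans (cong₂ (λ b m → (if b then 1 else 0) + m) (p≗q x) (count-map p≗q xs))
    (sym (count-∷ q (f x) (map f xs))))

count-none : ∀ {A : Set} {p : A → Bool} {xs} → All (λ x → p x ≡ false) xs → count p xs ≡ 0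
count-none []                   = refl
count-none {p = p} {x ∷ xs} (px ∷ pxs) =
  trans (count-∷ p x xs) (cong₂ (λ b m → (if b then 1 else 0) + m) px (count-none pxs))

count-replicate : ∀ {A : Set} {p : A → Bool} {x b} m → p x ≡ b →
                  count p (replicate m x) ≡ (if b then m else 0)
count-replicate {b = true}  zero px = refl
count-replicate {b = false} zero px = refl
count-replicate {p = p} {x} {true}  (suc m) px rewrite px = cong suc (count-replicate m px)
count-replicate {p = p} {x} {false} (suc m) px rewrite px = count-replicate m px

count-singletons : ∀ {n} (p : Vec (Fin n) 1 → Bool) →
                   count p (tuples n 1) ≡ count (λ i → p (i ∷ [])) (allFin n)
count-singletons {n} p = go (allFin n)
  where
  go : ∀ is → count p (cartesianProductWith _∷_ is ([] ∷ [])) ≡ count (λ i → p (i ∷ [])) is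
  go []       = refl
  go (i ∷ is) = trans (count-∷ p (i ∷ []) _)
    (trans (cong (λ m → (if p (i ∷ []) then 1 else 0) + m) (go is)) (sym (count-∷ (λ i → p (i ∷ [])) i is)))

≢⇒==-false : ∀ {k k′} → k ≢ k′ → (k == k′) ≡ false
≢⇒==-false {k} {k′} k≢k′ with k == k′ in eq
... | true  = ⊥-elim (k≢k′ (==⇒≡ k k′ (subst T (sym eq) _)))
... | false = refl

==-refl-true : ∀ k → (k == k) ≡ true
==-refl-true k = T-ext (λ _ → _) (λ _ → ==-refl k)

-- Here `p` stands for being a neighbour of the child with key `k` and passing a colour test, which
-- on leaves is `q`. Both counting terms are instances, with the identity and with `not`.
module _ {k : Key} {p : Node → Bool} {q : Bool → Bool}
         (p-leaf : ∀ c k′ → p (leaf c k′) ≡ (k == k′) ∧ q c) where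

  private
    leafCount : Key → ℕ
    leafCount (a , b) = (if q true then b else 0) + (if q false then a else 0)

  count-leaves : count p (leaves k) ≡ leafCount k
  count-leaves = trans (count-++ p (replicate (proj₂ k) (leaf true k)) _)
    (cong₂ _+_ (count-replicate (proj₂ k) (own true)) (count-replicate (proj₁ k) (own false)))
    where
    own : ∀ c → p (leaf c k) ≡ q c
    own c = trans (p-leaf c k) (cong (_∧ q c) (==-refl-true k))

  count-others : ∀ {ks} → All (k ≢_) ks → count p (concatMap leaves ks) ≡ 0
  count-others k∉ = count-none (All.concat⁺ (All.map⁺ (All.map (λ {k′} k≢k′ →
    All.map (λ { (c , refl) → trans (p-leaf c k′) (cong (_∧ q c) (≢⇒==-false k≢k′)) }) (leaves-of k′)) k∉)))

  count-all-leaves : ∀ {ks} → Unique ks → k ∈ ks → count p (concatMap leaves ks) ≡ leafCount k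
  count-all-leaves {k ∷ ks} (k∉ ∷ _) (here refl) =
    trans (count-++ p (leaves k) _) (trans (cong₂ _+_ count-leaves (count-others k∉)) (+-identityʳ _))
  count-all-leaves {k′ ∷ ks} (k′∉ ∷ unique) (there k∈) =
    trans (count-++ p (leaves k′) _) (cong₂ _+_ other (count-all-leaves unique k∈))
    where
    k≢k′ : k ≢ k′
    k≢k′ = All.lookup k′∉ k∈ ∘ sym
    other : count p (leaves k′) ≡ 0
    other = trans (cong (count p) (sym (++-identityʳ (leaves k′)))) (count-others (k≢k′ ∷ []))

  count-nodes : (∀ k′ → p (child k′) ≡ false) → ∀ vs es → Unique (vs ++ es) → k ∈ vs ++ es →
                count p (nodes vs es) ≡ (if p root then 1 else 0) + leafCount k
  count-nodes p-child vs es unique k∈ = begin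
    count p (nodes vs es)
      ≡⟨ count-++ p (map child vs) _ ⟩
    count p (map child vs) + count p (root ∷ map child es ++ concatMap leaves (vs ++ es))
      ≡⟨ cong₂ _+_ (children vs) (trans (count-∷ p root _) (cong (λ m → (if p root then 1 else 0) + m)
           (trans (count-++ p (map child es) _) (cong₂ _+_ (children es) (count-all-leaves unique k∈))))) ⟩
    (if p root then 1 else 0) + leafCount k ∎
    where
    open ≡-Reasoning
    children : ∀ ks → count p (map child ks) ≡ 0
    children ks = count-none (All.map⁺ (All.universal p-child ks))

-- The meaning of the edge formula in a tree given by keys.

module NodeTreeLogic (vs es : List Key) (unique-vs : Unique vs) (unique-es : Unique es)
                     (vs-zero : All (λ k → proj₁ k ≡ 0) vs) (es-suc : All (λ k → proj₁ k ≢ 0) es) where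

  disjoint : All (λ k → All (k ≢_) es) vs
  disjoint = All.map (λ k≡0 → All.map (λ k′≢0 k≡k′ → k′≢0 (trans (cong proj₁ (sym k≡k′)) k≡0)) es-suc) vs-zero

  open NodeTree vs es unique-vs unique-es disjoint public

  private
    N : ℕ
    N = length us

    unique : Unique (vs ++ es)
    unique = AllPairs.++⁺ unique-vs unique-es disjoint

    count-tuples : ∀ {p : Vec (Fin N) 1 → Bool} {q : Node → Bool} →
                   (∀ i → p (i ∷ []) ≡ q (lookup us i)) → count p (tuples N 1) ≡ count q us
    count-tuples {p} {q} p≗q = trans (count-singletons p) (trans (count-map p≗q (allFin N))
      (cong (count q) (trans (map-tabulate (λ i → i) (lookup us)) (tabulate-lookup us))))

  child∈us⁻ : ∀ {k} → child k ∈ us → k ∈ vs ++ es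
  child∈us⁻ child∈ with ∈-++⁻ (map child vs) child∈
  ... | inj₁ ∈vs with ∈-map⁻ child ∈vs
  ...   | _ , k∈ , refl = ∈-++⁺ˡ k∈
  child∈us⁻ child∈ | inj₂ (there ∈rest) with ∈-++⁻ (map child es) ∈rest
  ...   | inj₁ ∈es with ∈-map⁻ child ∈es
  ...     | _ , k∈ , refl = ∈-++⁺ʳ vs k∈
  child∈us⁻ child∈ | inj₂ (there ∈rest) | inj₂ ∈leaves with All.lookup allLeaves ∈leaves
  ... | _ , _ , ()

  module _ {i k} (i-child : lookup us i ≡ child k) where

    key∈ : k ∈ vs ++ es
    key∈ = child∈us⁻ (subst (_∈ us) i-child (∈-lookup i))

    eval-colouredNeighbours : evalTerm structure colouredNeighbours (i ∷ []) ≡ ℤ.+ suc (proj₂ k)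
    eval-colouredNeighbours = cong ℤ.+_ (trans
      (count-tuples {q = λ v → adjacent (child k) v ∧ colour₁ v} (λ j →
        trans (eval-∧′ structure (j ∷ i ∷ []) (E (suc zero) zero) (C₁ zero))
          (cong (λ u → adjacent u (lookup us j) ∧ colour₁ (lookup us j)) i-child)))
      (trans (count-nodes {q = λ c → c} (λ _ _ → refl) (λ _ → refl) vs es unique key∈)
             (cong suc (+-identityʳ (proj₂ k)))))

    eval-plainNeighbours : evalTerm structure plainNeighbours (i ∷ []) ≡ ℤ.+ proj₁ k
    eval-plainNeighbours = cong ℤ.+_ (trans
      (count-tuples {q = λ v → adjacent (child k) v ∧ not (colour₁ v)} (λ j →
        trans (eval-∧′ structure (j ∷ i ∷ []) (E (suc zero) zero) (¬′ C₁ zero))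
          (cong (λ u → adjacent u (lookup us j) ∧ not (colour₁ (lookup us j))) i-child)))
      (count-nodes {q = not} (λ _ _ → refl) (λ _ → refl) vs es unique key∈))

  open Structure structure using () renaming (E to edge)

  private
    module _ {n} (x y : Fin n) where
      firstPath secondPath : Formula (suc (suc n))
      firstPath  = EEP₌ (suc (suc x)) zero (suc zero) colouredNeighbours plainNeighbours
      secondPath = EEP₌ (suc (suc y)) zero (suc zero) colouredNeighbours colouredNeighbours

    -- These are the two possible middles of a path from a child. Either way the far end is a child,
    -- so the values of both terms there can be read off from its key.
    endpoint : ∀ {m e k} → lookup us m ≡ root ⊎ (∃[ c ] lookup us m ≡ leaf c k) → T (edge m e) →
               ∃[ k′ ] lookup us e ≡ child k′
    endpoint {m} {e} (inj₁ m-root) me =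
      root-adjacent⁻ (lookup us e) (subst (λ u → T (adjacent u (lookup us e))) m-root me)
    endpoint {m} {e} {k} (inj₂ (_ , m-leaf)) me =
      k , leaf-adjacent⁻ (lookup us e) (subst (λ u → T (adjacent u (lookup us e))) m-leaf me)

    -- Here the shift by one takes effect: vertex keys begin with zero, which is no successor.
    suc-key∈ : ∀ {k b} → k ∈ vs ⊎ k ∈ es → suc b ≡ proj₁ k → k ∈ es
    suc-key∈ (inj₂ k∈es) _ = k∈es
    suc-key∈ (inj₁ k∈vs) b≡ with () ← trans b≡ (All.lookup vs-zero k∈vs)

    key∈es : ∀ {i j e k l k′} → lookup us i ≡ child k → lookup us j ≡ child l → lookup us e ≡ child k′ →
      evalTerm structure colouredNeighbours (i ∷ []) ≡ evalTerm structure plainNeighbours (e ∷ []) →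
      evalTerm structure colouredNeighbours (j ∷ []) ≡ evalTerm structure colouredNeighbours (e ∷ []) →
      (suc (proj₂ k) , proj₂ l) ∈ es
    key∈es {k = k} {l} {k′} i-child j-child e-child i≡e j≡e =
      subst (_∈ es) (cong₂ _,_ (sym a≡) (sym b≡)) (suc-key∈ (∈-++⁻ vs (key∈ e-child)) a≡)
      where
      a≡ : suc (proj₂ k) ≡ proj₁ k′
      a≡ = ℤ.+-injective (trans (sym (eval-colouredNeighbours i-child)) (trans i≡e (eval-plainNeighbours e-child)))
      b≡ : proj₂ l ≡ proj₂ k′
      b≡ = suc-injective (ℤ.+-injective
        (trans (sym (eval-colouredNeighbours j-child)) (trans j≡e (eval-colouredNeighbours e-child))))

    paths⇒key∈es : ∀ {n} (x y : Fin n) ρ {m e k l} →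
      lookup us (Vec.lookup ρ x) ≡ child k → lookup us (Vec.lookup ρ y) ≡ child l →
      T (eval structure (firstPath x y) (m ∷ e ∷ ρ)) → T (eval structure (secondPath x y) (m ∷ e ∷ ρ)) →
      (suc (proj₂ k) , proj₂ l) ∈ es
    paths⇒key∈es x y ρ {m} {e} x-child y-child sat-x sat-y = combine
      (Equivalence.to (⊨-EEP₌ structure (m ∷ e ∷ ρ) (suc (suc x)) zero (suc zero)
                         colouredNeighbours plainNeighbours) sat-x)
      (Equivalence.to (⊨-EEP₌ structure (m ∷ e ∷ ρ) (suc (suc y)) zero (suc zero)
                         colouredNeighbours colouredNeighbours) sat-y)
      where
      combine : T (edge (Vec.lookup ρ x) m) × T (edge m e)
                  × evalTerm structure colouredNeighbours (Vec.lookup ρ x ∷ []) ≡ evalTerm structure plainNeighbours (e ∷ []) →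
                T (edge (Vec.lookup ρ y) m) × T (edge m e)
                  × evalTerm structure colouredNeighbours (Vec.lookup ρ y ∷ []) ≡ evalTerm structure colouredNeighbours (e ∷ []) → _
      combine (xm , me , x≡e) (_ , _ , y≡e) = key∈es x-child y-child
        (proj₂ (endpoint (child-adjacent⁻ (lookup us m) (subst (λ u → T (adjacent u (lookup us m))) x-child xm)) me))
        x≡e y≡e

  edgeFormula⁻ : ∀ {n} (x y : Fin n) ρ {k l} →
    lookup us (Vec.lookup ρ x) ≡ child k → lookup us (Vec.lookup ρ y) ≡ child l →
    T (eval structure (edgeFormula x y) ρ) → (suc (proj₂ k) , proj₂ l) ∈ es
  edgeFormula⁻ x y ρ x-child y-child sat = fromEdge
    (Equivalence.to (⊨-∃′ structure ρ (∃′ (firstPath x y ∧′ secondPath x y))) sat)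
    where
    fromMiddle : ∀ {e} → (∃[ m ] T (eval structure (firstPath x y ∧′ secondPath x y) (m ∷ e ∷ ρ))) → _
    fromMiddle {e} (m , sat₂) =
      let sat-x , sat-y = Equivalence.to (⊨-∧′ structure (m ∷ e ∷ ρ) (firstPath x y) (secondPath x y)) sat₂
      in paths⇒key∈es x y ρ x-child y-child sat-x sat-y
    fromEdge : (∃[ e ] T (eval structure (∃′ (firstPath x y ∧′ secondPath x y)) (e ∷ ρ))) → _
    fromEdge (e , sat₁) =
      fromMiddle (Equivalence.to (⊨-∃′ structure (e ∷ ρ) (firstPath x y ∧′ secondPath x y)) sat₁)

  edgeFormula⁺ : ∀ {n} (x y : Fin n) ρ {k l} →
    lookup us (Vec.lookup ρ x) ≡ child k → lookup us (Vec.lookup ρ y) ≡ child l →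
    (suc (proj₂ k) , proj₂ l) ∈ es → T (eval structure (edgeFormula x y) ρ)
  edgeFormula⁺ x y ρ {k} {l} x-child y-child key∈es =
    Equivalence.from (⊨-∃′ structure ρ (∃′ (firstPath x y ∧′ secondPath x y))) (e ,
    Equivalence.from (⊨-∃′ structure (e ∷ ρ) (firstPath x y ∧′ secondPath x y)) (r ,
    Equivalence.from (⊨-∧′ structure (r ∷ e ∷ ρ) (firstPath x y) (secondPath x y))
      ( Equivalence.from (⊨-EEP₌ structure (r ∷ e ∷ ρ) (suc (suc x)) zero (suc zero)
                            colouredNeighbours plainNeighbours)
          (child-root x-child , root-e , trans (eval-colouredNeighbours x-child) (sym (eval-plainNeighbours e-child)))
      , Equivalence.from (⊨-EEP₌ structure (r ∷ e ∷ ρ) (suc (suc y)) zero (suc zero)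
                            colouredNeighbours colouredNeighbours)
          (child-root y-child , root-e , trans (eval-colouredNeighbours y-child) (sym (eval-colouredNeighbours e-child))))))
    where
    e∈ : child (suc (proj₂ k) , proj₂ l) ∈ us
    e∈ = child∈us (∈-++⁺ʳ vs key∈es)
    e r : Fin N
    e = index e∈
    r = index root∈us
    e-child : lookup us e ≡ child (suc (proj₂ k) , proj₂ l)
    e-child = sym (lookup-index e∈)
    child-root : ∀ {i k} → lookup us i ≡ child k → T (edge i r)
    child-root {i} i-child = edge-to root∈us (subst (λ u → T (adjacent u root)) (sym i-child) _)
    root-e : T (edge r e)
    root-e = edge-sym e r (child-root e-child)

-- The keys of a graph.

countdown-injective : ∀ {n} {i j : Fin n} → countdown i ≡ countdown j → i ≡ j
countdown-injective {i = i} {j} eq =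
  trans (sym (Fin.opposite-involutive i)) (trans (cong opposite (Fin.toℕ-injective eq)) (Fin.opposite-involutive j))

concatMap-unique : ∀ {A B : Set} {f : A → List B} {xs} → Unique xs → (∀ x → Unique (f x)) →
  (∀ {x y z} → z ∈ f x → z ∈ f y → x ≡ y) → Unique (concatMap f xs)
concatMap-unique {f = f} {xs} unique unique-f disjoint-f = Unique.concat⁺
  (All.map⁺ (All.universal unique-f xs))
  (AllPairs.map⁺ (AllPairs.map (λ x≢y {_} (z∈fx , z∈fy) → x≢y (disjoint-f z∈fx z∈fy)) unique))

∈-edgeKeysAt⁻ : ∀ {n} {row : Fin n → Bool} {a k} → k ∈ edgeKeysAt row a →
                ∃[ j ] T (row j) × k ≡ (suc a , countdown j)
∈-edgeKeysAt⁻ {n} {row} {a} k∈ = let j , _ , k∈j = find (∈-concatMap⁻ _ {xs = allFin n} k∈) in j , singleton j k∈j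
  where
  singleton : ∀ {k} j → k ∈ (if row j then [ suc a , countdown j ] else []) → T (row j) × k ≡ (suc a , countdown j)
  singleton j k∈ with row j | k∈
  ... | true | here eq = _ , eq

∈-edgeKeysAt⁺ : ∀ {n} {row : Fin n → Bool} {a} j → T (row j) → (suc a , countdown j) ∈ edgeKeysAt row a
∈-edgeKeysAt⁺ {n} {row} {a} j row-j = ∈-concatMap⁺ _ (lose (∈-allFin j) (singleton row-j))
  where
  singleton : T (row j) → (suc a , countdown j) ∈ (if row j then [ suc a , countdown j ] else [])
  singleton t with row j | t
  ... | true | _ = here refl

edgeKeysAt-unique : ∀ {n} (row : Fin n → Bool) a → Unique (edgeKeysAt row a)
edgeKeysAt-unique {n} row a = concatMap-unique (Unique.allFin⁺ n) unique₁ disjoint₁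
  where
  unique₁ : ∀ j → Unique (if row j then [ suc a , countdown j ] else [])
  unique₁ j with row j
  ... | true  = [] ∷ []
  ... | false = []
  disjoint₁ : ∀ {i j k} → k ∈ (if row i then [ suc a , countdown i ] else []) →
              k ∈ (if row j then [ suc a , countdown j ] else []) → i ≡ j
  disjoint₁ {i} {j} k∈i k∈j with row i | row j | k∈i | k∈j
  ... | true | true | here refl | here eq = countdown-injective (cong proj₂ eq)

module _ {n} (edge : Fin n → Fin n → Bool) where

  ∈-edgeKeys⁻ : ∀ {k} → k ∈ edgeKeys edge → ∃[ i ] ∃[ j ] T (edge i j) × k ≡ (suc (countdown i) , countdown j)
  ∈-edgeKeys⁻ k∈ =
    let i , _ , k∈i = find (∈-concatMap⁻ (λ i → edgeKeysAt (edge i) (countdown i)) {xs = allFin n} k∈)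
        j , ij , eq = ∈-edgeKeysAt⁻ {row = edge i} k∈i
    in i , j , ij , eq

  ∈-edgeKeys : ∀ i j → ((suc (countdown i) , countdown j) ∈ edgeKeys edge) ⇔ T (edge i j)
  ∈-edgeKeys i j = mk⇔ to (λ ij → ∈-concatMap⁺ _ (lose (∈-allFin i) (∈-edgeKeysAt⁺ {row = edge i} j ij)))
    where
    to : (suc (countdown i) , countdown j) ∈ edgeKeys edge → T (edge i j)
    to k∈ with i′ , j′ , i′j′ , eq ← ∈-edgeKeys⁻ k∈
      = subst₂ (λ i j → T (edge i j)) (countdown-injective (sym (suc-injective (cong proj₁ eq))))
               (countdown-injective (sym (cong proj₂ eq))) i′j′

  edgeKeys-unique : Unique (edgeKeys edge)
  edgeKeys-unique = concatMap-unique (Unique.allFin⁺ n) (λ i → edgeKeysAt-unique (edge i) (countdown i))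
    (λ {i} {j} k∈i k∈j → countdown-injective (suc-injective (trans
      (sym (cong proj₁ (proj₂ (proj₂ (∈-edgeKeysAt⁻ {row = edge i} k∈i)))))
      (cong proj₁ (proj₂ (proj₂ (∈-edgeKeysAt⁻ {row = edge j} k∈j)))))))

  edgeKeys-suc : All (λ k → proj₁ k ≢ 0) (edgeKeys edge)
  edgeKeys-suc = All.tabulate λ k∈ k≡0 → let _ , _ , _ , eq = ∈-edgeKeys⁻ k∈ in suc≢0 (trans (sym (cong proj₁ eq)) k≡0)
    where
    suc≢0 : ∀ {m} → suc m ≢ 0
    suc≢0 ()

vertexKeys-unique : ∀ n → Unique (vertexKeys n)
vertexKeys-unique n = Unique.map⁺ (countdown-injective ∘ cong proj₂) (Unique.allFin⁺ n)

vertexKeys-zero : ∀ n → All (λ k → proj₁ k ≡ 0) (vertexKeys n)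
vertexKeys-zero n = All.map⁺ (All.universal (λ _ → refl) (allFin n))

-- The indices belong to lists of different lengths, so they are compared through `toℕ`. The two
-- maps match those in the list of vertex children.
lookup-map-map-tabulate : ∀ {A B C : Set} (f : B → C) (g : A → B) {n} (h : Fin n → A) ys i v → toℕ i ≡ toℕ v →
                          lookup (map f (map g (tabulate h)) ++ ys) i ≡ f (g (h v))
lookup-map-map-tabulate f g h ys zero    zero    eq = refl
lookup-map-map-tabulate f g h ys (suc i) (suc v) eq =
  lookup-map-map-tabulate f g (h ∘ suc) ys i v (suc-injective eq)

lookup-++-∈ : ∀ {A : Set} (xs ys : List A) i → toℕ i < length xs ⊎ lookup (xs ++ ys) i ∈ ys
lookup-++-∈ []       ys i       = inj₂ (∈-lookup i)
lookup-++-∈ (x ∷ xs) ys zero    = inj₁ (s≤s z≤n)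
lookup-++-∈ (x ∷ xs) ys (suc i) with lookup-++-∈ xs ys i
... | inj₁ i<  = inj₁ (s≤s i<)
... | inj₂ ∈ys = inj₂ ∈ys

-- Interpretation of a graph in its tree.

module GraphTree (G : Graph) where

  open Graph G renaming (order to n) using (edge)

  open NodeTreeLogic (vertexKeys n) (edgeKeys edge) (vertexKeys-unique n) (edgeKeys-unique edge)
                     (vertexKeys-zero n) (edgeKeys-suc edge) public

  private
    N : ℕ
    N = length us

    length-vertices : length (map child (vertexKeys n)) ≡ n
    length-vertices = trans (length-map child (vertexKeys n))
      (trans (length-map _ (allFin n)) (length-tabulate (λ i → i)))

  n≤N : n ≤ N
  n≤N = ≤-trans (≤-reflexive (sym length-vertices)) (length-++-≤ˡ (map child (vertexKeys n)))

  lookup-vertex : ∀ i v → toℕ i ≡ toℕ v → lookup us i ≡ child (0 , countdown v)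
  lookup-vertex = lookup-map-map-tabulate child (λ i → 0 , countdown i) {n} (λ i → i)
    (root ∷ map child (edgeKeys edge) ++ concatMap leaves (vertexKeys n ++ edgeKeys edge))

  embed : Fin n → Fin N
  embed v = inject≤ v n≤N

  lookup-embed : ∀ v → lookup us (embed v) ≡ child (0 , countdown v)
  lookup-embed v = lookup-vertex (embed v) v (Fin.toℕ-inject≤ v n≤N)

  colour₂-vertices : ∀ i → T (colour₂ (lookup us i)) ⇔ toℕ i < n
  colour₂-vertices i = mk⇔ (to (lookup-++-∈ (map child (vertexKeys n)) _ i)) from
    where
    others : All (λ v → ¬ T (colour₂ v)) (root ∷ map child (edgeKeys edge) ++ concatMap leaves (vertexKeys n ++ edgeKeys edge))
    others = (λ ()) ∷ All.++⁺ (All.map⁺ (All.map nonzero (edgeKeys-suc edge)))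
                               (All.map (λ { (_ , _ , refl) () }) allLeaves)
      where
      nonzero : ∀ {k} → proj₁ k ≢ 0 → ¬ T (colour₂ (child k))
      nonzero {zero  , _} ≢0 _ = ≢0 refl
      nonzero {suc _ , _} _  ()
    to : toℕ i < length (map child (vertexKeys n)) ⊎
         lookup us i ∈ root ∷ map child (edgeKeys edge) ++ concatMap leaves (vertexKeys n ++ edgeKeys edge) →
         T (colour₂ (lookup us i)) → toℕ i < n
    to (inj₁ i<) _ = ≤-trans i< (≤-reflexive length-vertices)
    to (inj₂ ∈rest) coloured = ⊥-elim (All.lookup others ∈rest coloured)
    from : toℕ i < n → T (colour₂ (lookup us i))
    from i<n = subst (T ∘ colour₂) (sym (lookup-vertex i (fromℕ< i<n) (sym (Fin.toℕ-fromℕ< i<n)))) _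

  edgeFormula-correct : ∀ {m} (x y : Fin m) ρ {v w} →
    Vec.lookup ρ x ≡ embed v → Vec.lookup ρ y ≡ embed w →
    T (eval structure (edgeFormula x y) ρ) ⇔ T (edge v w)
  edgeFormula-correct x y ρ {v} {w} x≡v y≡w = mk⇔
    (λ sat → Equivalence.to (∈-edgeKeys edge v w) (edgeFormula⁻ x y ρ x-child y-child sat))
    (λ vw → edgeFormula⁺ x y ρ x-child y-child (Equivalence.from (∈-edgeKeys edge v w) vw))
    where
    x-child : lookup us (Vec.lookup ρ x) ≡ child (0 , countdown v)
    x-child = trans (cong (lookup us) x≡v) (lookup-embed v)
    y-child : lookup us (Vec.lookup ρ y) ≡ child (0 , countdown w)
    y-child = trans (cong (lookup us) y≡w) (lookup-embed w)

  eval-edgeFormula : ∀ {m} (x y : Fin m) ρ {v w} →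
    Vec.lookup ρ x ≡ embed v → Vec.lookup ρ y ≡ embed w →
    eval structure (edgeFormula x y) ρ ≡ edge v w
  eval-edgeFormula x y ρ x≡v y≡w = T-ext (Equivalence.to correct) (Equivalence.from correct)
    where
    correct : T (eval structure (edgeFormula x y) ρ) ⇔ T (edge _ _)
    correct = edgeFormula-correct x y ρ x≡v y≡w

  embed-fromℕ< : ∀ i (i<n : toℕ i < n) → embed (fromℕ< i<n) ≡ i
  embed-fromℕ< i i<n = Fin.toℕ-injective (trans (Fin.toℕ-inject≤ (fromℕ< i<n) n≤N) (Fin.toℕ-fromℕ< i<n))

  -- The edge formula is only controlled on the image of `embed`. Assignments stay in that image
  -- because the guard `C₂` confines every witness to it.
  eval-translate : ∀ {m} (φ : FO m) (ρ : Vec (Fin n) m) →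
                   eval structure (translate φ) (Vec.map embed ρ) ≡ evalFO G φ ρ
  eval-translate (x ≐ y) ρ rewrite lookup-map x embed ρ | lookup-map y embed ρ = T-ext
    (λ t → fromWitness (Fin.inject≤-injective n≤N n≤N _ _ (toWitness t)))
    (λ t → fromWitness (cong embed (toWitness t)))
  eval-translate (E x y) ρ = eval-edgeFormula x y (Vec.map embed ρ) (lookup-map x embed ρ) (lookup-map y embed ρ)
  eval-translate (¬′ φ) ρ = cong not (eval-translate φ ρ)
  eval-translate (φ ∨′ ψ) ρ = cong₂ _∨_ (eval-translate φ ρ) (eval-translate ψ ρ)
  eval-translate (∃′ φ) ρ = T-ext
    (λ t → to (Equivalence.to (⊨-∃′ structure (Vec.map embed ρ) (C₂ zero ∧′ translate φ)) t))
    (λ t → from (Equivalence.to T-any-allFin t))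
    where
    to : (∃[ i ] T (eval structure (C₂ zero ∧′ translate φ) (i ∷ Vec.map embed ρ))) → T (evalFO G (∃′ φ) ρ)
    to (i , sat) =
      let coloured , sat-φ = Equivalence.to (⊨-∧′ structure (i ∷ Vec.map embed ρ) (C₂ zero) (translate φ)) sat
          i<n = Equivalence.to (colour₂-vertices i) coloured
      in Equivalence.from T-any-allFin (fromℕ< i<n , subst T (eval-translate φ (fromℕ< i<n ∷ ρ))
           (subst (λ j → T (eval structure (translate φ) (j ∷ Vec.map embed ρ))) (sym (embed-fromℕ< i i<n)) sat-φ))
    from : (∃[ v ] T (evalFO G φ (v ∷ ρ))) → T (eval structure (translate (∃′ φ)) (Vec.map embed ρ))
    from (v , sat) = Equivalence.from (⊨-∃′ structure (Vec.map embed ρ) (C₂ zero ∧′ translate φ)) (embed v ,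
      Equivalence.from (⊨-∧′ structure (embed v ∷ Vec.map embed ρ) (C₂ zero) (translate φ))
        ( subst (T ∘ colour₂) (sym (lookup-embed v)) _
        , subst T (sym (eval-translate φ (v ∷ ρ))) sat ))

-- The translation of sentences

neighbourCodes plainCodes : Value
plainCodes     = encodeTerm colouredNeighbours ∙ encodeTerm plainNeighbours
neighbourCodes = encodeTerm colouredNeighbours ∙ encodeTerm colouredNeighbours

-- In `pathCode`, the code `x` of a variable is raised by two for the quantifiers it passes, the
-- other variables are 0 and 1, and `t` holds the codes of both terms.
andCode pathCode : Value → Value → Value
andCode u v  = unary 4 ∙ unary 5 ∙ (unary 4 ∙ u) ∙ (unary 4 ∙ v)
pathCode t x = unary 7 ∙ (nil ∙ nil ∙ x) ∙ nil ∙ (nil ∙ nil) ∙ t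

edgeCode : Value → Value → Value
edgeCode x y = unary 6 ∙ unary 6 ∙ andCode (pathCode plainCodes x) (pathCode neighbourCodes y)

existsCode : Value → Value
existsCode u = unary 6 ∙ andCode (unary 3 ∙ nil) u

andCodeᶠ : PolyFun → PolyFun → PolyFun
andCodeᶠ f g = constᶠ (unary 4) & constᶠ (unary 5) & (constᶠ (unary 4) & f) & (constᶠ (unary 4) & g)

pathCodeᶠ : Value → PolyFun → PolyFun
pathCodeᶠ t f = constᶠ (unary 7) & (nilᶠ & nilᶠ & f) & nilᶠ & trueᶠ & constᶠ t

edgeCodeᶠ : PolyFun
edgeCodeᶠ = constᶠ (unary 6) & constᶠ (unary 6) & andCodeᶠ (pathCodeᶠ plainCodes hdᶠ) (pathCodeᶠ neighbourCodes tlᶠ)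

existsCodeᶠ : PolyFun
existsCodeᶠ = constᶠ (unary 6) & andCodeᶠ (constᶠ (unary 3 ∙ nil)) idᶠ

-- The operands of a disjunction are the halves of the second half of its
-- code.  The paramorphism therefore returns, together with the translation
-- of a code, the translations of its two halves.
codeᶠ translateStepᶠ : PolyFun
codeᶠ =
  if leftᶠ thenᶠ
    if leftᶠ ⨟ tlᶠ thenᶠ
      if leftᶠ ⨟ tlᶠ ⨟ tlᶠ thenᶠ
        if leftᶠ ⨟ tlᶠ ⨟ tlᶠ ⨟ tlᶠ thenᶠ
          rightResultᶠ ⨟ hdᶠ ⨟ existsCodeᶠ
        else constᶠ (unary 5) & rightResultᶠ ⨟ tlᶠ
      else constᶠ (unary 4) & rightResultᶠ ⨟ hdᶠ
    else rightᶠ ⨟ edgeCodeᶠ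
  else leftᶠ & rightᶠ
translateStepᶠ = codeᶠ & leftResultᶠ ⨟ hdᶠ & rightResultᶠ ⨟ hdᶠ

private
  translations : Value → Value → Value
  translations = paraᵛ (fun nilᶠ) (fun translateStepᶠ)

-- Opaque, since unification would otherwise compute with the numeral.
opaque
  growth : ℕ
  growth = 200 + (size plainCodes + size neighbourCodes)

  growth-large : 200 + (size plainCodes + size neighbourCodes) ≤ growth
  growth-large = ≤-refl

size-andCode : ∀ u v → size (andCode u v) ≡ 43 + (size u + size v)
size-andCode u v = eq (size u) (size v)
  where
  eq : ∀ u v → suc (9 + suc (11 + suc (suc (9 + u) + suc (9 + v)))) ≡ 43 + (u + v)
  eq = solve-∀

size-pathCode : ∀ t x → size (pathCode t x) ≡ 27 + (size t + size x)
size-pathCode t x = eq (size t) (size x)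
  where
  eq : ∀ t x → suc (15 + suc (suc (1 + suc (1 + x)) + suc (1 + suc (3 + t)))) ≡ 27 + (t + x)
  eq = solve-∀

size-halves : ∀ y → size (hdᵛ y) + size (tlᵛ y) ≤ 1 + size y
size-halves nil     = ≤-refl
size-halves (x ∙ y) = m≤n⇒m≤1+n (n≤1+n _)

size-edgeCode : ∀ x y → size (edgeCode x y) ≡ 125 + (size plainCodes + size neighbourCodes) + (size x + size y)
size-edgeCode x y = trans
  (cong (28 +_) (trans (size-andCode (pathCode plainCodes x) (pathCode neighbourCodes y))
    (cong₂ (λ m n → 43 + (m + n)) (size-pathCode plainCodes x) (size-pathCode neighbourCodes y))))
  (eq (size plainCodes) (size neighbourCodes) (size x) (size y))
  where
  eq : ∀ p q x y → 28 + (43 + ((27 + (p + x)) + (27 + (q + y)))) ≡ 125 + (p + q) + (x + y)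
  eq = solve-∀

private
  literal≤growth : ∀ c → T (c ≤ᵇ 200) → c ≤ growth
  literal≤growth c c≤ = ≤-trans (≤ᵇ⇒≤ c 200 c≤) (≤-trans (m≤m+n 200 (size plainCodes + size neighbourCodes)) growth-large)

  instance
    growth-nonZero : NonZero growth
    growth-nonZero = >-nonZero (literal≤growth 1 _)

  ≤-growth : ∀ a {b} c {_ : T (a ≤ᵇ 200)} → b ≤ growth * c → a + b ≤ growth + growth * c
  ≤-growth a c {a≤} b≤ = +-mono-≤ (literal≤growth a a≤) b≤

  self≤growth : ∀ m → m ≤ growth * m
  self≤growth m = m≤n*m m growth

-- Every case adds a constant amount to `y` or to one component of the result for `y`, and the
-- summand `growth` pays for it.
size-code : ∀ x y c rx ry → size (hdᵛ ry) ≤ growth * size y → size (tlᵛ ry) ≤ growth * size y →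
            size (fun codeᶠ (c ∙ x ∙ y ∙ rx ∙ ry)) ≤ growth + growth * size y
size-code nil y _ _ _ _ _ = ≤-growth 2 (size y) (self≤growth (size y))
size-code (_ ∙ nil) y _ _ _ _ _ = begin
  size (edgeCode (hdᵛ y) (tlᵛ y))        ≡⟨ size-edgeCode (hdᵛ y) (tlᵛ y) ⟩
  125 + p + (size (hdᵛ y) + size (tlᵛ y)) ≤⟨ +-monoʳ-≤ (125 + p) (size-halves y) ⟩
  125 + p + (1 + size y)                 ≡⟨ eq p (size y) ⟩
  -- Apart from the codes of the terms, 126 is the largest constant of all cases; the 200 in
  -- `growth` leaves room to spare.
  126 + p + size y                       ≤⟨ +-mono-≤ (≤-trans (+-monoˡ-≤ p (m≤m+n 126 74)) growth-large) (self≤growth (size y)) ⟩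
  growth + growth * size y               ∎
  where
  open ≤-Reasoning
  p : ℕ
  p = size plainCodes + size neighbourCodes
  eq : ∀ p y → 125 + p + (1 + y) ≡ 126 + p + y
  eq = solve-∀
size-code (_ ∙ _ ∙ nil) y _ _ _ hd≤ _ = ≤-growth 10 (size y) hd≤
size-code (_ ∙ _ ∙ _ ∙ nil) y _ _ _ _ tl≤ = ≤-growth 12 (size y) tl≤
size-code (_ ∙ _ ∙ _ ∙ _ ∙ _) y _ _ ry hd≤ _ =
  subst (_≤ growth + growth * size y) (sym (cong (14 +_) (size-andCode (unary 3 ∙ nil) (hdᵛ ry))))
    (≤-growth 66 (size y) hd≤)

-- Both components are bounded together, since the code of a disjunction is built from the second
-- component of the result for its right half. That component holds only the first components of
-- earlier results, so nothing is nested and the bound remains linear.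
size-translations : ∀ c v → size (hdᵛ (translations c v)) ≤ growth * size v × size (tlᵛ (translations c v)) ≤ growth * size v
size-translations c nil = self≤growth 1 , self≤growth 1
size-translations c (x ∙ y) = code≤ , halves≤
  where
  open ≤-Reasoning
  code≤ : size (hdᵛ (translations c (x ∙ y))) ≤ growth * size (x ∙ y)
  code≤ = begin
    _                        ≤⟨ size-code x y c (translations c x) (translations c y) (proj₁ (size-translations c y)) (proj₂ (size-translations c y)) ⟩
    growth + growth * size y ≡⟨ *-suc growth (size y) ⟨
    growth * suc (size y)    ≤⟨ *-monoʳ-≤ growth (s≤s (m≤n+m (size y) (size x))) ⟩
    growth * size (x ∙ y)    ∎
  halves≤ : size (tlᵛ (translations c (x ∙ y))) ≤ growth * size (x ∙ y)
  halves≤ = begin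
    suc (size (hdᵛ (translations c x)) + size (hdᵛ (translations c y)))
      ≤⟨ +-mono-≤ (literal≤growth 1 _) (+-mono-≤ (proj₁ (size-translations c x)) (proj₁ (size-translations c y))) ⟩
    growth + (growth * size x + growth * size y) ≡⟨ cong (growth +_) (*-distribˡ-+ growth (size x) (size y)) ⟨
    growth + growth * (size x + size y)          ≡⟨ *-suc growth (size x + size y) ⟨
    growth * size (x ∙ y)                        ∎

size≤halves : ∀ v → size v ≤ 1 + (size (hdᵛ v) + size (tlᵛ v))
size≤halves nil     = s≤s z≤n
size≤halves (x ∙ y) = ≤-refl

translateᶠ : PolyFun
translateᶠ = (nilᶠ & idᶠ) ⨟ paraᶠ nilᶠ translateStepᶠ (con 1 ⊕ (con growth ⊗ var ⊕ con growth ⊗ var))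
  (λ c v → ≤-trans (size≤halves (translations c v)) (s≤s (+-mono-≤
    (≤-trans (proj₁ (size-translations c v)) (*-monoʳ-≤ growth (m≤n+m (size v) (size c))))
    (≤-trans (proj₂ (size-translations c v)) (*-monoʳ-≤ growth (m≤n+m (size v) (size c))))))) ⨟ hdᶠ

fun-translateᶠ : ∀ {n} (φ : FO n) → fun translateᶠ (encodeFO φ) ≡ encodeFormula (translate φ)
fun-translateᶠ (x ≐ y)  = refl
fun-translateᶠ (E x y)  = refl
fun-translateᶠ (¬′ φ)   = cong (unary 4 ∙_) (fun-translateᶠ φ)
fun-translateᶠ (φ ∨′ ψ) = cong₂ (λ u v → unary 5 ∙ u ∙ v) (fun-translateᶠ φ) (fun-translateᶠ ψ)
fun-translateᶠ (∃′ φ)   = cong existsCode (fun-translateᶠ φ)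

-- The parameter is the size of the sentence, so this is the parameter bound of the reduction. It is
-- inherited from the paramorphism that computes the code.
size-translate : ∀ {n} (φ : FO n) → size (encodeFormula (translate φ)) ≤ growth * size (encodeFO φ)
size-translate φ = subst (λ v → size v ≤ growth * size (encodeFO φ)) (fun-translateᶠ φ)
  (proj₁ (size-translations nil (encodeFO φ)))

-- Composition of reductions

polynomialTime : ∀ {A B : Set} (encA : A → Value) (encB : B → Value) (f : A → B) (p : PolyFun) →
                 (∀ a → fun p (encA a) ≡ encB (f a)) → PolynomialTime encA encB f
polynomialTime encA encB f p eq =
  let c , d , bound≤ = monomialBound (bound p)
  in program p , c , d , λ a → let t , run , t≤ = runs p (encA a) in
       t , subst (λ v → program p ∶ encA a ⇓ v ⟨ t ⟩) (eq a) run , ≤-trans t≤ (bound≤ (size (encA a)))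

Computable-polynomial : ∀ {f g : ℕ → ℕ} → Computable f → (p : PolyFun) →
                        (∀ n → fun p (unary n) ≡ unary (g n)) → Computable (λ n → g (f n))
Computable-polynomial {f} {g} (q , runs-q) p eq = (q ⨾ program p) , λ n →
  let s , run-q = runs-q n
      t , run-p , _ = runs p (unary (f n))
  in suc (s + t) , run-⨾ run-q (subst (λ v → program p ∶ unary (f n) ⇓ v ⟨ t ⟩) (eq (f n)) run-p)

-- The time factors of an fpt reduction need not be monotone in the
-- parameter; composing with reductions of the following kind avoids
-- evaluating such a factor at a mere bound on the parameter.
record PolyReduction (P Q : ParameterisedProblem) : Set where
  private
    module P = ParameterisedProblem P
    module Q = ParameterisedProblem Q
  field
    reduce   : P.Instance → Q.Instance
    correct  : ∀ i → P.Yes i ⇔ Q.Yes (reduce i)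
    polyTime : PolynomialTime P.encode Q.encode reduce
    factor   : ℕ
    bounded  : ∀ i → Q.parameter (reduce i) ≤ factor * P.parameter i

-- Composing it with a `PolyReduction` yields an fpt reduction.
≤fpt-refl : ∀ {P} → P ≤fpt P
≤fpt-refl = record
  { reduce          = λ i → i
  ; correct         = λ i → mk⇔ (λ y → y) (λ y → y)
  ; program         = id′
  ; timeFactor      = λ _ → 1
  ; timeComputable  = program (constᶠ (unary 1)) , λ n → let t , run , _ = runs (constᶠ (unary 1)) (unary n) in t , run
  ; exponent        = 0
  ; computes        = λ i → 1 , run-id , ≤-refl
  ; paramBound      = λ n → n
  ; paramComputable = id′ , λ n → 1 , run-id
  ; paramBounded    = λ i → ≤-refl
  }

[m*n]^o≡m^o*n^o : ∀ m n o → (m * n) ^ o ≡ m ^ o * n ^ o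
[m*n]^o≡m^o*n^o m n zero    = refl
[m*n]^o≡m^o*n^o m n (suc o) = trans (cong (m * n *_) ([m*n]^o≡m^o*n^o m n o))
  ([m*n]*[o*p]≡[m*o]*[n*p] m n (m ^ o) (n ^ o))

module _ (s a e c d t₁ t₂ y : ℕ) .{{_ : NonZero s}}
         (t₁≤ : t₁ ≤ a * s ^ e) (y≤ : y ≤ s + t₁) (t₂≤ : t₂ ≤ c * y ^ d) where

  private
    A : ℕ
    A = suc a * s ^ suc e

    open ≤-Reasoning

    1≤s^ : ∀ m → 1 ≤ s ^ m
    1≤s^ m = m^n>0 s m

    s≤s^ : s ≤ s ^ suc e
    s≤s^ = ≤-trans (≤-reflexive (sym (^-identityʳ s))) (^-monoʳ-≤ s {1} {1 + e} (s≤s z≤n))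

    s+t₁≤A : s + t₁ ≤ A
    s+t₁≤A = +-mono-≤ s≤s^ (≤-trans t₁≤ (*-monoʳ-≤ a (^-monoʳ-≤ s {e} {1 + e} (n≤1+n e))))

    1≤A : 1 ≤ A
    1≤A = ≤-trans (1≤s^ (suc e)) (m≤m+n (s ^ suc e) _)

    instance
      A-nonZero : NonZero A
      A-nonZero = >-nonZero 1≤A

  -- `A` bounds the size of the input plus the time of the first program, hence the input of the
  -- second. Its factor and exponents are increased by one so that 1, `A` and `A ^ d` are all at
  -- most `A ^ suc d`, even when a, e or d is zero; the three summands then give the factor 2 + c.
  compositionTime : suc (t₁ + t₂) ≤ (2 + c) * suc a ^ suc d * s ^ (suc e * suc d)
  compositionTime = begin
    suc (t₁ + t₂)                  ≤⟨ s≤s (+-mono-≤ (m+n≤o⇒n≤o s s+t₁≤A) (≤-trans t₂≤ (*-monoʳ-≤ c (^-monoˡ-≤ d (≤-trans y≤ s+t₁≤A))))) ⟩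
    1 + (A + c * A ^ d)            ≤⟨ +-mono-≤ (m^n>0 A (suc d)) (+-mono-≤ A≤ (*-monoʳ-≤ c (^-monoʳ-≤ A {d} {1 + d} (n≤1+n d)))) ⟩
    A ^ suc d + (A ^ suc d + c * A ^ suc d) ≡⟨⟩
    (2 + c) * A ^ suc d            ≡⟨ cong ((2 + c) *_) ([m*n]^o≡m^o*n^o (suc a) (s ^ suc e) (suc d)) ⟩
    (2 + c) * (suc a ^ suc d * (s ^ suc e) ^ suc d) ≡⟨ cong (λ m → (2 + c) * (suc a ^ suc d * m)) (^-*-assoc s (suc e) (suc d)) ⟩
    (2 + c) * (suc a ^ suc d * s ^ (suc e * suc d)) ≡⟨ *-assoc (2 + c) (suc a ^ suc d) _ ⟨
    (2 + c) * suc a ^ suc d * s ^ (suc e * suc d) ∎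
    where
    A≤ : A ≤ A ^ suc d
    A≤ = ≤-trans (≤-reflexive (sym (^-identityʳ A))) (^-monoʳ-≤ A {1} {1 + d} (s≤s z≤n))

≤fpt-PolyReduction : ∀ {P Q R} → P ≤fpt Q → PolyReduction Q R → P ≤fpt R
≤fpt-PolyReduction {P} {Q} {R} P≤Q Q≤R =
  let q , c , d , computes-q = Q≤R.polyTime in record
  { reduce          = λ i → Q≤R.reduce (P≤Q.reduce i)
  ; correct         = λ i → Q≤R.correct (P≤Q.reduce i) ⇔-∘ P≤Q.correct i
  ; program         = P≤Q.program ⨾ q
  ; timeFactor      = λ n → (2 + c) * suc (P≤Q.timeFactor n) ^ suc d
  ; timeComputable  = Computable-polynomial {g = λ m → (2 + c) * suc m ^ suc d} P≤Q.timeComputable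
      ((constᶠ (unary (2 + c)) & (nilᶠ & idᶠ) ⨟ powerᶠ (suc d)) ⨟ timesᶠ)
      (λ m → trans (cong₂ (λ u v → fun timesᶠ (u ∙ v)) (fun-constᶠ (unary (2 + c)) (unary m)) (fun-powerᶠ (suc d) (suc m)))
                   (fun-timesᶠ (2 + c) (suc m ^ suc d)))
  ; exponent        = suc P≤Q.exponent * suc d
  ; computes        = λ i →
      let t₁ , run₁ , t₁≤ = P≤Q.computes i
          t₂ , run₂ , t₂≤ = computes-q (P≤Q.reduce i)
      in suc (t₁ + t₂) , run-⨾ run₁ run₂ ,
         compositionTime (size (P.encode i)) (P≤Q.timeFactor (P.parameter i)) P≤Q.exponent c d t₁ t₂ _
           t₁≤ (size-output run₁) t₂≤
  ; paramBound      = λ n → Q≤R.factor * P≤Q.paramBound n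
  ; paramComputable = Computable-polynomial {g = Q≤R.factor *_} P≤Q.paramComputable
      ((constᶠ (unary Q≤R.factor) & idᶠ) ⨟ timesᶠ)
      (λ m → trans (cong (λ u → fun timesᶠ (u ∙ unary m)) (fun-constᶠ (unary Q≤R.factor) (unary m)))
                   (fun-timesᶠ Q≤R.factor m))
  ; paramBounded    = λ i → ≤-trans (Q≤R.bounded (P≤Q.reduce i)) (*-monoʳ-≤ Q≤R.factor (P≤Q.paramBounded i))
  }
  where
  module P   = ParameterisedProblem P
  module P≤Q = _≤fpt_ P≤Q
  module Q≤R = PolyReduction Q≤R

-- The reduction between the model-checking problems.

graphTree : Graph → ColouredTree 2
graphTree G = GraphTree.tree G

fun-graphTree : ∀ G → fun graphToStructureᶠ (encodeGraph G) ≡ encodeTree (graphTree G)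
fun-graphTree G = trans (fun-graphToStructureᶠ (Graph.edge G))
  (sym (encode-nodeStructure (graphNodes (Graph.edge G)) (GraphTree.root∈us G)))

translateInstance : FO 0 × Graph → Formula 0 × ColouredTree 2
translateInstance (φ , G) = translate φ , graphTree G

MC-reduction : PolyReduction MC-FO-Graphs (MC-𝓛-ColouredTrees 2)
MC-reduction = record
  { reduce   = translateInstance
  ; correct  = λ (φ , G) → let eq = GraphTree.eval-translate G φ [] in mk⇔ (subst T (sym eq)) (subst T eq)
  ; polyTime = polynomialTime (ParameterisedProblem.encode MC-FO-Graphs)
                 (ParameterisedProblem.encode (MC-𝓛-ColouredTrees 2)) translateInstance
                 (hdᶠ ⨟ translateᶠ & tlᶠ ⨟ graphToStructureᶠ)
                 (λ (φ , G) → cong₂ _∙_ (fun-translateᶠ φ) (fun-graphTree G))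
  ; factor   = growth
  ; bounded  = λ (φ , G) → size-translate φ
  }

mainTheorem7 : (Σ[ φV ∈ Formula 1 ] Σ[ φE ∈ Formula 2 ] Σ[ tree ∈ (Graph → ColouredTree 2) ]
    PolynomialTime encodeGraph encodeTree tree
    × ((G : Graph) →
    Σ[ V⊆V ∈ Graph.order G ≤ ColouredTree.order (tree G) ]
    ((v : Fin (ColouredTree.order (tree G))) →
    (tree G ⊨ φV [ v ∷ [] ]) ⇔ (toℕ v < Graph.order G))
    × ((v₁ v₂ : Fin (Graph.order G)) →
    (tree G ⊨ φE [ inject≤ v₁ V⊆V ∷ inject≤ v₂ V⊆V ∷ [] ])
    ⇔ T (Graph.edge G v₁ v₂))))
    × (MC-FO-Graphs ≤fpt MC-𝓛-ColouredTrees 2)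
    × (AW[*]-hard MC-FO-Graphs → AW[*]-hard (MC-𝓛-ColouredTrees 2))
mainTheorem7 =
    ( C₂ zero , edgeFormula zero (suc zero) , graphTree , polynomialTime encodeGraph encodeTree graphTree graphToStructureᶠ fun-graphTree
    , λ G → GraphTree.n≤N G , GraphTree.colour₂-vertices G
          , λ v₁ v₂ → GraphTree.edgeFormula-correct G zero (suc zero)
                        (GraphTree.embed G v₁ ∷ GraphTree.embed G v₂ ∷ []) {v₁} {v₂} refl refl )
  , ≤fpt-PolyReduction ≤fpt-refl MC-reduction
  , λ hard Q Q∈ → ≤fpt-PolyReduction (hard Q Q∈) MC-reduction
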